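{- Let $\Gamma$ be block-finite and let $(\mathbb G,E)$, $\mathbb G^*$ be as below. Assume either (a) $m=2$ and $\Gamma$ admits a cyclic fractional polymorphism of arity at least $2$, or (b) $m\ge3$ and $\Gamma$ admits a symmetric fractional polymorphism of arity $m-1$. Let $\hat x\in\mathrm{Range}_1(\mathbb G^*)$ and let $f\in\langle\Gamma\rangle$ have arity $m$ with $\arg\min f=\mathbb G(\hat x)$. Then for every pair of distinct indices $i,j\in[m]$ there exists $x\in\arg\min f$ with $x_i=x_j$.
   Context: $D$ finite, cost functions $f:D^n\to\mathbb Q\cup\{\infty\}$, $\mathrm{dom} f=\{x:f(x)<\infty\}$. Block-finite: $D$ partitioned into $\{D_v:v\in V\}$ with (a) for each $a\in D_v$ a unary $g_a:D\to D$ mapping $\mathrm{dom} f$ into itself for all $f\in\Gamma$, with $g_a(b)=a$ for $b\in D_v$; (b) $\mathrm{dom} f\in\Gamma$ for $f\in\Gamma$, and equality $=_D\in\Gamma$; (c) each $n$-ary $f\in\Gamma\setminus\{=_D\}$ has $\mathrm{dom} f\subseteq D_{v_1}\times\dots\times D_{v_n}$. $\langle\Gamma\rangle$: functions obtained by minimizing a $\mathrm{VCSP}(\Gamma)$ objective over some of its variables. $k$-ary fractional polymorphism: probability distribution $\nu$ on $g:D^k\to D$ with $\sum\nu(g)f(g(x^1,\dots,x^k))\le\frac1k\sum f(x^i)$ for $f\in\Gamma$, $x^i\in\mathrm{dom} f$; cyclic/symmetric if all support operations are invariant under cyclic shift/all permutations of arguments. Maps $\mathbf g=(g_1,\dots,g_m):D^m\to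 D^m$ act on $[D^n]^m$ coordinatewise; $f^m(x)=\frac1m\sum f(x^i)$; generalized fractional polymorphism of arity $m\to m$: finitely supported distribution $\rho$ on maps with $\sum\rho(\mathbf g)f^m(\mathbf g(x))\le f^m(x)$ for $f\in\Gamma$, $x\in[\mathrm{dom} f]^m$. $\Omega=\{\mathbf g:(g_{\pi(1)},\dots,g_{\pi(m)})(x)=\mathbf g(x_{\pi(1)},\dots,x_{\pi(m)})\ \forall x\in D^m,\pi\}$. $\omega$: generalized fractional polymorphism of arity $m\to m$ with support in $\Omega$ containing the support of every other such. $\mathbb G=\{\mathbf g_k\circ\dots\circ\mathbf g_1:k\ge0,\mathbf g_i\in\mathrm{supp}(\omega)\}$, $E=\{(\mathbf g,\mathbf h\circ\mathbf g):\mathbf g\in\mathbb G,\mathbf h\in\mathrm{supp}(\omega)\}$; $\mathbb G^*$ is the union of strongly connected components of $(\mathbb G,E)$ with no outgoing edges; $\mathrm{Range}_1(\mathbb G^*)=\{\mathbf g(y):\mathbf g\in\mathbb G^*,y\in D^m\}$; $\mathbb G(\hat x)=\{\mathbf g(\hat x):\mathbf g\in\mathbb G\}$. -}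

module Defs where

open import Data.Empty using (⊥)
open import Data.Fin using (Fin)
import Data.Fin.Properties as Fin
open import Data.Fin.Permutation using (Permutation′; _⟨$⟩ʳ_)
open import Data.Integer using (+_)
open import Data.List using (List; foldr)
open import Data.List.Relation.Unary.All using (All)
open import Data.List.Relation.Unary.Any using (Any)
open import Data.Maybe using (map; zipWith)
open import Data.Nat as ℕ using (ℕ; zero; suc; _⊔_)
import Data.Nat.Properties as ℕ
open import Data.Product using (Σ-syntax; ∃-syntax; _×_; _,_; proj₁)
open import Data.Rational
  using (ℚ; 0ℚ; 1ℚ; ½; _+_; _-_; _*_; ∣_∣; 1/_; _/_; _≤_; _<_;
         NonZero; Positive; positive; nonNegative)
open import Data.Rational.Properties
open import Data.Rational.Solver using (module +-*-Solver)
open import Data.Sum using (_⊎_)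
open import Data.Vec as Vec using (Vec; []; _∷_; _∷ʳ_; _++_; lookup; tabulate; transpose)
open import Function using (_∘_; _∘′_; id; const)
open import Level using (Level; 0ℓ)
import Level
open import Relation.Binary.Construct.Closure.ReflexiveTransitive using (Star)
import Relation.Binary.Construct.Add.Supremum.NonStrict as NonStrict
import Relation.Binary.Construct.Add.Supremum.Strict as Strict
open import Relation.Binary.PropositionalEquality
  using (_≡_; _≗_; refl; sym; trans; cong; subst)
open import Relation.Nullary using (¬_; yes; no)
open import Relation.Nullary.Construct.Add.Supremum using (_⁺; [_]; ⊤⁺)
open import Relation.Unary using (Pred; _∈_; _⊆_)

private
  variable
    a b ℓ : Level
    A : Set a
    B : Set b
    d k m n : ℕ

-- Real numbers, as Cauchy sequences of rationals.  Fractional polymorphisms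
-- have real weights, but only the ordered ℚ-vector space structure of the
-- reals is needed because cost functions are rational-valued.

record ℝ : Set where
  field
    seq    : ℕ → ℚ
    cauchy : ∀ ε → 0ℚ < ε → ∃[ N ] ∀ i j → N ℕ.≤ i → N ℕ.≤ j → ∣ seq i - seq j ∣ < ε

open ℝ public

private
  halve : ∀ ε → 0ℚ < ε → 0ℚ < ½ * ε
  halve ε 0<ε = subst (_< ½ * ε) (*-zeroʳ ½) (*-monoʳ-<-pos ½ 0<ε)

  halves : ∀ ε → ½ * ε + ½ * ε ≡ ε
  halves ε = trans (sym (*-distribʳ-+ ε ½ ½)) (*-identityˡ ε)

  difference-+ : ∀ p q r s → (p + q) - (r + s) ≡ (p - r) + (q - s)
  difference-+ = solve 4 (λ p q r s → (p :+ q) :- (r :+ s) := (p :- r) :+ (q :- s)) refl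
    where open +-*-Solver

  difference-* : ∀ q r s → q * r - q * s ≡ q * (r - s)
  difference-* = solve 3 (λ q r s → q :* r :- q :* s := q :* (r :- s)) refl
    where open +-*-Solver

infixl 6 _+ℝ_
infixr 7 _·ℝ_
infix  4 _≤ℝ_ _≈ℝ_

fromℚ : ℚ → ℝ
fromℚ q .seq    = const q
fromℚ q .cauchy = λ ε 0<ε → 0 , λ _ _ _ _ → subst (_< ε) (cong ∣_∣ (sym (+-inverseʳ q))) 0<ε

_+ℝ_ : ℝ → ℝ → ℝ
(x +ℝ y) .seq i = seq x i + seq y i
(x +ℝ y) .cauchy ε 0<ε =
  let (M , p) = cauchy x (½ * ε) (halve ε 0<ε)
      (N , q) = cauchy y (½ * ε) (halve ε 0<ε)
  in M ⊔ N , λ i j i≥ j≥ →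
     subst (λ z → ∣ z ∣ < ε) (sym (difference-+ (seq x i) (seq y i) (seq x j) (seq y j)))
       (≤-<-trans (∣p+q∣≤∣p∣+∣q∣ (seq x i - seq x j) (seq y i - seq y j))
         (subst (∣ seq x i - seq x j ∣ + ∣ seq y i - seq y j ∣ <_) (halves ε)
           (+-mono-< (p i j (ℕ.m⊔n≤o⇒m≤o M N i≥) (ℕ.m⊔n≤o⇒m≤o M N j≥))
                     (q i j (ℕ.m⊔n≤o⇒n≤o M N i≥) (ℕ.m⊔n≤o⇒n≤o M N j≥)))))

_·ℝ_ : ℚ → ℝ → ℝ
(q ·ℝ x) .seq i = q * seq x i
(q ·ℝ x) .cauchy ε 0<ε =
  let (N , p) = cauchy x (1/ c * ε) 0<ε/c
  in N , λ i j i≥ j≥ →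
     subst (_< ε)
       (sym (trans (cong ∣_∣ (difference-* q (seq x i) (seq x j)))
                   (∣p*q∣≡∣p∣*∣q∣ q (seq x i - seq x j))))
       (≤-<-trans
         (*-monoʳ-≤-nonNeg ∣ seq x i - seq x j ∣ {{nonNegative (0≤∣p∣ (seq x i - seq x j))}} ∣q∣≤c)
         (subst (c * ∣ seq x i - seq x j ∣ <_) c*ε/c≡ε (*-monoʳ-<-pos c (p i j i≥ j≥))))
  where
  c : ℚ
  c = ∣ q ∣ + 1ℚ

  instance
    c-pos : Positive c
    c-pos = positive (+-mono-≤-< {0ℚ} {∣ q ∣} {0ℚ} {1ℚ} (0≤∣p∣ q) (positive⁻¹ 1ℚ))

    c-nonZero : NonZero c
    c-nonZero = pos⇒nonZero c

    1/c-pos : Positive (1/ c)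
    1/c-pos = 1/pos⇒pos c

  ∣q∣≤c : ∣ q ∣ ≤ c
  ∣q∣≤c = subst (_≤ c) (+-identityʳ ∣ q ∣) (+-monoʳ-≤ ∣ q ∣ {0ℚ} {1ℚ} (nonNegative⁻¹ 1ℚ))

  0<ε/c : 0ℚ < 1/ c * ε
  0<ε/c = subst (_< 1/ c * ε) (*-zeroʳ (1/ c)) (*-monoʳ-<-pos (1/ c) 0<ε)

  c*ε/c≡ε : c * (1/ c * ε) ≡ ε
  c*ε/c≡ε = trans (sym (*-assoc c (1/ c) ε))
                  (trans (cong (_* ε) (*-inverseʳ c)) (*-identityˡ ε))

_≤ℝ_ : ℝ → ℝ → Set
x ≤ℝ y = ∀ ε → 0ℚ < ε → ∃[ N ] ∀ i → N ℕ.≤ i → seq x i ≤ seq y i + ε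

_≈ℝ_ : ℝ → ℝ → Set
x ≈ℝ y = x ≤ℝ y × y ≤ℝ x

Positiveℝ : ℝ → Set
Positiveℝ x = ∃[ ε ] 0ℚ < ε × ∃[ N ] ∀ i → N ℕ.≤ i → ε ≤ seq x i

-- ⊤⁺ is ∞.

open NonStrict _≤_  public using () renaming (_≤⁺_ to _≤∞_)
open NonStrict _≤ℝ_ public using () renaming (_≤⁺_ to _≤ℝ∞_)
open Strict    _<_  public using () renaming (_<⁺_ to _<∞_)

infixl 6 _+∞_

_+∞_ : ℚ ⁺ → ℚ ⁺ → ℚ ⁺
_+∞_ = zipWith _+_

-- The mean of the empty vector is a junk value.
mean : Vec (ℚ ⁺) n → ℚ ⁺
mean {zero}  _  = [ 0ℚ ]
mean {suc n} vs = map ((+ 1 / suc n) *_) (Vec.foldr′ _+∞_ [ 0ℚ ] vs)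

-- A finitely supported probability distribution on functions, listing only
-- functions of positive weight.  A function may be listed repeatedly (its
-- probability is then the sum of the weights), and functions are compared
-- pointwise, so the support consists of everything pointwise equal to a listed
-- function.

record Distribution (A : Set a) (B : Set b) : Set (a Level.⊔ b) where
  field
    atoms            : List (ℝ × (A → B))
    weights-positive : All (Positiveℝ ∘ proj₁) atoms
    weights-total    : foldr (λ (w , _) s → w +ℝ s) (fromℚ 0ℚ) atoms ≈ℝ fromℚ 1ℚ

open Distribution public

supp : {A : Set a} {B : Set b} → Distribution A B → Pred (A → B) (a Level.⊔ b)
supp ρ g = Any (λ (_ , h) → g ≗ h) (atoms ρ)

-- A value ∞ at an atom makes the whole sum ∞, as all weights are positive.
expectation : Distribution A B → ((A → B) → ℚ ⁺) → ℝ ⁺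
expectation ρ F =
  foldr (λ (w , g) s → zipWith _+ℝ_ (map (_·ℝ w) (F g)) s) [ fromℚ 0ℚ ] (atoms ρ)

-- The finite domain D is Fin d throughout.

Points : ℕ → ℕ → Set
Points d n = Vec (Fin d) n

CostFunction : ℕ → ℕ → Set
CostFunction d n = Points d n → ℚ ⁺

dom : CostFunction d n → Pred (Points d n) 0ℓ
dom f x = f x <∞ ⊤⁺

argmin : CostFunction d n → Pred (Points d n) 0ℓ
argmin f x = ∀ y → f x ≤∞ f y

domCost : CostFunction d n → CostFunction d n
domCost f x = map (const 0ℚ) (f x)

equality : CostFunction d 2
equality (x ∷ y ∷ []) with x Fin.≟ y
... | yes _ = [ 0ℚ ]
... | no  _ = ⊤⁺

IsEquality : CostFunction d n → Set
IsEquality {n = 2} f = f ≗ equality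
IsEquality {n = _} f = ⊥

record Language (d : ℕ) (ℓ : Level) : Set (Level.suc ℓ) where
  field
    Member      : CostFunction d n → Set ℓ
    Member-resp : {f g : CostFunction d n} → f ≗ g → Member f → Member g

open Language public

-- The blocks D_v are the fibres of `block`, and `retract a` is g_a.
record BlockFinite (Γ : Language d ℓ) : Set ℓ where
  field
    #blocks : ℕ
    block   : Fin d → Fin #blocks

    retract            : Fin d → Fin d → Fin d
    retract-dom        : ∀ a {n} (f : CostFunction d n) → Member Γ f →
                         ∀ x → x ∈ dom f → Vec.map (retract a) x ∈ dom f
    retract-block      : ∀ a b → block b ≡ block a → retract a b ≡ a

    dom-member         : ∀ {n} (f : CostFunction d n) → Member Γ f → Member Γ (domCost f)
    equality-member    : Member Γ equality

    dom-in-block       : ∀ {n} (f : CostFunction d n) → Member Γ f → ¬ IsEquality f →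
                         ∃[ v ] ∀ x → x ∈ dom f → Vec.map block x ≡ v

record Constraint (Γ : Language d ℓ) (n : ℕ) : Set ℓ where
  field
    {arity} : ℕ
    cost    : CostFunction d arity
    member  : Member Γ cost
    scope   : Vec (Fin n) arity

objective : {Γ : Language d ℓ} → List (Constraint Γ n) → CostFunction d n
objective cs x = foldr (λ c s → cost c (Vec.map (lookup x) (scope c)) +∞ s) [ 0ℚ ] cs
  where open Constraint

-- Members of ⟨ Γ ⟩ keep the first m of the m + l variables of an instance and
-- minimize over the others.
⟨_⟩ : Language d ℓ → CostFunction d m → Set ℓ
⟨_⟩ {d = d} {m = m} Γ f =
  Σ[ l ∈ ℕ ] Σ[ cs ∈ List (Constraint Γ (m ℕ.+ l)) ] ∀ (x : Points d m) →
    (∀ (y : Points d l) → f x ≤∞ objective cs (x ++ y)) ×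
    (∃[ y ] f x ≡ objective cs (x ++ y))

IsFractionalPolymorphism : Language d ℓ → Distribution (Points d k) (Fin d) → Set ℓ
IsFractionalPolymorphism {d = d} {k = k} Γ ν =
  ∀ {n} (f : CostFunction d n) → Member Γ f →
  ∀ (xs : Vec (Points d n) k) → (∀ i → lookup xs i ∈ dom f) →
  expectation ν (λ g → f (Vec.map g (transpose xs))) ≤ℝ∞ map fromℚ (mean (Vec.map f xs))

permute : Permutation′ n → Vec A n → Vec A n
permute π x = tabulate (λ i → lookup x (π ⟨$⟩ʳ i))

rotate : Vec A n → Vec A n
rotate []       = []
rotate (x ∷ xs) = xs ∷ʳ x

IsCyclic : Pred (Distribution (Points d k) (Fin d)) 0ℓ
IsCyclic ν = ∀ g → g ∈ supp ν → ∀ x → g (rotate x) ≡ g x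

IsSymmetric : Pred (Distribution (Points d k) (Fin d)) 0ℓ
IsSymmetric ν = ∀ g → g ∈ supp ν → ∀ π x → g (permute π x) ≡ g x

Map : ℕ → ℕ → Set
Map d m = Points d m → Points d m

_power_ : CostFunction d n → (m : ℕ) → Vec (Points d n) m → ℚ ⁺
(f power m) xs = mean (Vec.map f xs)

coordinatewise : Map d m → Vec (Points d n) m → Vec (Points d n) m
coordinatewise g xs = transpose (Vec.map g (transpose xs))

IsGeneralized : Language d ℓ → Distribution (Points d m) (Points d m) → Set ℓ
IsGeneralized {d = d} {m = m} Γ ρ =
  ∀ {n} (f : CostFunction d n) → Member Γ f →
  ∀ (xs : Vec (Points d n) m) → (∀ i → lookup xs i ∈ dom f) →
  expectation ρ (λ g → (f power m) (coordinatewise g xs)) ≤ℝ∞ map fromℚ ((f power m) xs)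

Ω : Pred (Map d m) 0ℓ
Ω g = ∀ π x → permute π (g x) ≡ g (permute π x)

record IsMaximal (Γ : Language d ℓ) (ω : Distribution (Points d m) (Points d m)) : Set ℓ where
  field
    generalized : IsGeneralized Γ ω
    supp⊆Ω      : supp ω ⊆ Ω
    maximal     : ∀ ρ → IsGeneralized Γ ρ → supp ρ ⊆ Ω → supp ρ ⊆ supp ω

-- The graph (𝔾, E); vertices that agree pointwise are identified.

module _ {d m : ℕ} (ω : Distribution (Points d m) (Points d m)) where

  𝔾 : Pred (Map d m) 0ℓ
  𝔾 g = ∃[ hs ] All (supp ω) hs × g ≗ foldr _∘′_ id hs

  E : Map d m → Map d m → Set
  E g g′ = g ∈ 𝔾 × ∃[ h ] h ∈ supp ω × g′ ≗ h ∘ g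

  Reachable : Map d m → Map d m → Set
  Reachable = Star (λ g g′ → g ≗ g′ ⊎ E g g′)

  SameComponent : Map d m → Map d m → Set
  SameComponent g g′ = Reachable g g′ × Reachable g′ g

  𝔾* : Pred (Map d m) 0ℓ
  𝔾* g = g ∈ 𝔾 × (∀ g′ g″ → SameComponent g g′ → E g′ g″ → SameComponent g g″)

  Range₁𝔾* : Pred (Points d m) 0ℓ
  Range₁𝔾* x = ∃[ g ] g ∈ 𝔾* × ∃[ y ] x ≡ g y

  𝔾-orbit : Points d m → Pred (Points d m) 0ℓ
  𝔾-orbit x̂ x = ∃[ g ] g ∈ 𝔾 × x ≡ g x̂

{-# OPTIONS --safe #-}
-- Let R = argmin f = 𝔾(x̂), which is closed under supp ω.  By maximality, supp ω
-- contains the map that fixes the tuples inside a block and sends all others to a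
-- constant tuple, since the latter never occur as columns in the domain of a
-- constraint other than equality.  Hence either R has a constant tuple, or the
-- entries of each x ∈ R lie in one block and the retractions give
-- f (xᵣ, …, xᵣ) < ∞ for all r.
--
-- m = 2: the swap of the arguments lies in supp ω, so (a, b), (b, a) ∈ R where
-- x̂ = (a, b).  A cyclic g maps the rows (a, b), (b, a), (a, a), …, (a, a) to a
-- pair (z, z), and the mean of its cost is closer to min f than f (a, a) is.
--
-- m ≥ 3: a symmetric g of arity m − 1 yields the map x ↦ (g (x without xᵣ))ᵣ, which
-- lies in supp ω.  Let τ = (i j) and choose rows Yᵣ with entries xᵣ and x_τr in the
-- columns i and j, where Yᵢ = x.  Applying g to all rows but the r-th gives such
-- rows for the image of x, and the total excess of f over min f of the rows r ≠ i
-- shrinks in the mean by the factor (m − 2) / (m − 1).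
--
-- In both cases, finiteness of the domain forces the excess down to 0.
module Submission where

open import Defs
open import Data.Fin using (Fin)
open import Data.Nat using (ℕ; _≤_; _∸_)
open import Data.Product using (Σ-syntax; ∃-syntax; _×_)
open import Data.Sum using (_⊎_)
open import Data.Vec using (lookup)
open import Level using (Level)
open import Relation.Binary.PropositionalEquality using (_≡_; _≢_)
open import Relation.Unary using (_∈_; _≐_)

open import Algebra.Bundles using (CommutativeMonoid; CommutativeRing)
import Algebra.Properties.CommutativeMonoid.Sum as MonoidSum
import Algebra.Properties.CommutativeSemigroup as CommutativeSemigroup
import Algebra.Properties.Group as Group
import Algebra.Properties.Semiring.Sum as SemiringSum
open import Data.Empty using (⊥; ⊥-elim)
import Data.Fin as Fin
open import Data.Fin using (zero; suc; punchIn; punchOut; opposite)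
import Data.Fin.Induction as Fin
open import Data.Fin.Permutation using (Permutation′; _⟨$⟩ʳ_; _⟨$⟩ˡ_; remove; punchIn-permute; inverseʳ; transpose)
import Data.Fin.Properties as Fin
open import Data.Integer using (+_)
import Data.Integer as ℤ
import Data.Integer.Properties as ℤ
open import Data.List as List using (List; []; _∷_)
open import Data.List.Relation.Unary.All as All using (All; []; _∷_)
import Data.List.Relation.Unary.All.Properties as All
open import Data.List.Relation.Unary.Any as Any using (Any; here)
import Data.List.Relation.Unary.Any.Properties as Any
import Data.Maybe as Maybe
import Data.Maybe.Properties as Maybe
open import Data.Nat as ℕ using (zero; suc; _⊔_; s≤s)
import Data.Nat.Properties as ℕ
open import Data.Product using (_,_; proj₁; proj₂)
open import Data.Rational
  using (ℚ; 0ℚ; 1ℚ; ½; _+_; -_; _*_; 1/_; _/_; _<_; positive; nonNegative; Positive; toℚᵘ)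
  renaming (_≤_ to _≤ℚ_)
open import Data.Rational.Properties
open import Data.Rational.Solver using (module +-*-Solver)
import Data.Rational.Unnormalised as ℚᵘ
import Data.Rational.Unnormalised.Properties as ℚᵘ
open import Data.Sum as Sum using (inj₁; inj₂; [_,_]′)
open import Data.Vec as Vec using (Vec; []; _∷_; tabulate)
open import Data.Vec.Functional using (insertAt)
open import Data.Vec.Functional.Properties using (insertAt-lookup; insertAt-punchIn)
open import Data.Vec.Properties
  using (lookup-⊛; lookup-splitAt; tabulate-cong; tabulate∘lookup; lookup∘tabulate; lookup-map; lookup-replicate; map-++)
open import Function using (_∘_; const; id)
open import Function.Bundles using (module Injection)
open import Function.Properties.Inverse using (↔⇒↣)
open import Induction.WellFounded using (WellFounded; Acc; acc; module Subrelation)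
import Level
import Relation.Binary.Construct.Add.Supremum.NonStrict as NonStrict
open NonStrict using (_≤⊤⁺)
import Relation.Binary.Construct.Add.Supremum.Strict as Strict
import Relation.Binary.Construct.On as On
open import Relation.Binary.PropositionalEquality
  using (_≗_; refl; sym; trans; cong; cong₂; subst; subst₂; module ≡-Reasoning)
open import Relation.Nullary using (Dec; yes; no; ¬_)
open import Relation.Nullary.Construct.Add.Supremum using (_⁺; [_]; ⊤⁺)
open import Relation.Nullary.Decidable using (dec-true; dec-false; from-no; map′)
open import Relation.Unary using (_⊆_)

open MonoidSum +-0-commutativeMonoid using (sum; sum-remove; ∑-distrib-+; sum-cong-≗)
open SemiringSum (CommutativeRing.semiring +-*-commutativeRing) using (*-distribˡ-sum)
open Group +-0-group using (∙-cancelˡ)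
open CommutativeSemigroup (CommutativeMonoid.commutativeSemigroup +-0-commutativeMonoid) using (interchange; x∙yz≈y∙xz)

private
  variable
    a b ℓ : Level
    A : Set a
    B : Set b
    d k m n : ℕ
    p q : ℚ

pattern finite≤ p≤q = NonStrict.[_] p≤q

-- Rational sums and averages

sum-mono-≤ : {s t : Fin n → ℚ} → (∀ i → s i ≤ℚ t i) → sum s ≤ℚ sum t
sum-mono-≤ {zero}  _   = ≤-refl
sum-mono-≤ {suc n} s≤t = +-mono-≤ (s≤t zero) (sum-mono-≤ (s≤t ∘ suc))

sum-mono-< : {s t : Fin n → ℚ} → (∀ i → s i ≤ℚ t i) → ∀ i → s i < t i → sum s < sum t
sum-mono-< s≤t zero    s<t = +-mono-<-≤ s<t (sum-mono-≤ (s≤t ∘ suc))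
sum-mono-< s≤t (suc i) s<t = +-mono-≤-< (s≤t zero) (sum-mono-< (s≤t ∘ suc) i s<t)

average : (Fin (suc n) → ℚ) → ℚ
average {n} s = + 1 / suc n * sum s

1/suc-pos : ∀ n → Positive (+ 1 / suc n)
1/suc-pos n = normalize-pos 1 (suc n)

-- `_/_` divides by a gcd and does not compute for a variable `n`; the unnormalised rationals do, so
-- the identity is checked there.
suc/1 : ∀ n → + suc n / 1 ≡ 1ℚ + + n / 1
suc/1 n = toℚᵘ-injective (begin
  toℚᵘ (+ suc n / 1)                  ≈⟨ toℚᵘ-fromℚᵘ (ℚᵘ.mkℚᵘ (+ suc n) 0) ⟩
  ℚᵘ.mkℚᵘ (+ suc n) 0                 ≈⟨ ℚᵘ.*≡* (cong (λ z → (+ 1 ℤ.+ z) ℤ.* + 1) (sym (ℤ.*-identityʳ (+ n)))) ⟩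
  ℚᵘ.1ℚᵘ ℚᵘ.+ ℚᵘ.mkℚᵘ (+ n) 0         ≈⟨ ℚᵘ.+-congʳ ℚᵘ.1ℚᵘ (toℚᵘ-fromℚᵘ (ℚᵘ.mkℚᵘ (+ n) 0)) ⟨
  ℚᵘ.1ℚᵘ ℚᵘ.+ toℚᵘ (+ n / 1)          ≈⟨ toℚᵘ-homo-+ 1ℚ (+ n / 1) ⟨
  toℚᵘ (1ℚ + + n / 1)                 ∎)
  where open ℚᵘ.≃-Reasoning

1/suc*suc : ∀ n → + 1 / suc n * (+ suc n / 1) ≡ 1ℚ
1/suc*suc n = toℚᵘ-injective (begin
  toℚᵘ (+ 1 / suc n * (+ suc n / 1))              ≈⟨ toℚᵘ-homo-* (+ 1 / suc n) (+ suc n / 1) ⟩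
  toℚᵘ (+ 1 / suc n) ℚᵘ.* toℚᵘ (+ suc n / 1)      ≈⟨ ℚᵘ.*-cong (toℚᵘ-fromℚᵘ (ℚᵘ.mkℚᵘ (+ 1) n)) (toℚᵘ-fromℚᵘ (ℚᵘ.mkℚᵘ (+ suc n) 0)) ⟩
  ℚᵘ.mkℚᵘ (+ 1) n ℚᵘ.* ℚᵘ.mkℚᵘ (+ suc n) 0        ≈⟨ ℚᵘ.*-inverseˡ (ℚᵘ.mkℚᵘ (+ suc n) 0) ⟩
  ℚᵘ.1ℚᵘ                                          ∎)
  where open ℚᵘ.≃-Reasoning

sum-const : ∀ n q → sum {n} (const q) ≡ (+ n / 1) * q
sum-const zero    q = sym (*-zeroˡ q)
sum-const (suc n) q = begin
  q + sum {n} (const q)      ≡⟨ cong₂ _+_ (sym (*-identityˡ q)) (sum-const n q) ⟩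
  1ℚ * q + (+ n / 1) * q     ≡⟨ *-distribʳ-+ q 1ℚ (+ n / 1) ⟨
  (1ℚ + + n / 1) * q         ≡⟨ cong (_* q) (suc/1 n) ⟨
  (+ suc n / 1) * q          ∎
  where open ≡-Reasoning

average-const : ∀ n q → average {n} (const q) ≡ q
average-const n q = begin
  + 1 / suc n * sum {suc n} (const q)      ≡⟨ cong (+ 1 / suc n *_) (sum-const (suc n) q) ⟩
  + 1 / suc n * ((+ suc n / 1) * q)        ≡⟨ *-assoc (+ 1 / suc n) (+ suc n / 1) q ⟨
  + 1 / suc n * (+ suc n / 1) * q          ≡⟨ cong (_* q) (1/suc*suc n) ⟩
  1ℚ * q                                   ≡⟨ *-identityˡ q ⟩
  q                                        ∎
  where open ≡-Reasoning

average-mono-< : {s t : Fin (suc n) → ℚ} → (∀ i → s i ≤ℚ t i) → ∀ i → s i < t i → average s < average t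
average-mono-< {n} s≤t i s<t = *-monoʳ-<-pos (+ 1 / suc n) {{1/suc-pos n}} (sum-mono-< s≤t i s<t)

average-mono-≤ : {s t : Fin (suc n) → ℚ} → (∀ i → s i ≤ℚ t i) → average s ≤ℚ average t
average-mono-≤ {n} s≤t = *-monoˡ-≤-nonNeg (+ 1 / suc n) {{pos⇒nonNeg (+ 1 / suc n) {{1/suc-pos n}}}} (sum-mono-≤ s≤t)

average-+ : ∀ (s t : Fin (suc n) → ℚ) → average s + average t ≡ average (λ i → s i + t i)
average-+ {n} s t = trans (sym (*-distribˡ-+ (+ 1 / suc n) (sum s) (sum t))) (cong (+ 1 / suc n *_) (sym (∑-distrib-+ s t)))

-- An entry is left out of one of the `n + 2` averages and has weight `1 / (n + 1)` in each of the
-- other `n + 1`. Adding `sum s` to both sides restores the omitted entries, so that every summand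
-- becomes the full sum.
sum-average-punchIn : ∀ (s : Fin (suc (suc n)) → ℚ) →
                      sum (λ r → average (s ∘ punchIn r)) ≡ sum s
sum-average-punchIn {n} s = begin
  sum (λ r → average (s ∘ punchIn r))         ≡⟨ *-distribˡ-sum w (λ r → sum (s ∘ punchIn r)) ⟨
  w * sum (λ r → sum (s ∘ punchIn r))         ≡⟨ cong (w *_) split ⟩
  w * ((+ suc n / 1) * sum s)                 ≡⟨ *-assoc w (+ suc n / 1) (sum s) ⟨
  w * (+ suc n / 1) * sum s                   ≡⟨ cong (_* sum s) (1/suc*suc n) ⟩
  1ℚ * sum s                                  ≡⟨ *-identityˡ (sum s) ⟩
  sum s                                       ∎
  where
  open ≡-Reasoning
  w = + 1 / suc n
  total : sum s + sum (λ r → sum (s ∘ punchIn r)) ≡ sum s + (+ suc n / 1) * sum s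
  total = begin
    sum s + sum (λ r → sum (s ∘ punchIn r))   ≡⟨ ∑-distrib-+ s (λ r → sum (s ∘ punchIn r)) ⟨
    sum (λ r → s r + sum (s ∘ punchIn r))     ≡⟨ sum-cong-≗ (λ r → sym (sum-remove {i = r} s)) ⟩
    sum {suc (suc n)} (const (sum s))         ≡⟨⟩
    sum s + sum {suc n} (const (sum s))       ≡⟨ cong (λ t → sum s + t) (sum-const (suc n) (sum s)) ⟩
    sum s + (+ suc n / 1) * sum s             ∎
  split : sum (λ r → sum (s ∘ punchIn r)) ≡ (+ suc n / 1) * sum s
  split = ∙-cancelˡ (sum s) _ _ total

-- Of the averages in `sum-average-punchIn` only the one omitting `i` is discarded. It exceeds
-- `s i`, as its terms are at least `s i` and one of them is larger. This is the decrease of the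
-- total excess in the symmetric case.
sum-average-punchIn-< : ∀ (s : Fin (suc (suc n)) → ℚ) i → (∀ r → s i ≤ℚ s r) → ∀ r → s i < s (punchIn i r) →
                        sum (λ r → average (s ∘ punchIn (punchIn i r))) < sum (s ∘ punchIn i)
sum-average-punchIn-< {n} s i least r i<r =
  +-cancelˡ-< (average (s ∘ punchIn i)) (begin-strict
    average (s ∘ punchIn i) + sum (λ r → average (s ∘ punchIn (punchIn i r)))
      ≡⟨ sum-remove {i = i} (λ r → average (s ∘ punchIn r)) ⟨
    sum (λ r → average (s ∘ punchIn r))         ≡⟨ sum-average-punchIn s ⟩
    sum s                                       ≡⟨ sum-remove {i = i} s ⟩
    s i + sum (s ∘ punchIn i)                   ≡⟨ cong (_+ sum (s ∘ punchIn i)) (average-const n (s i)) ⟨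
    average {n} (const (s i)) + sum (s ∘ punchIn i)   <⟨ +-monoˡ-< (sum (s ∘ punchIn i)) (average-mono-< (λ r → least (punchIn i r)) r i<r) ⟩
    average (s ∘ punchIn i) + sum (s ∘ punchIn i) ∎)
  where
  open ≤-Reasoning
  +-cancelˡ-< : ∀ p {q r} → p + q < p + r → q < r
  +-cancelˡ-< p {q} {r} lt = subst₂ _<_ (cancel p q) (cancel p r) (+-monoʳ-< (- p) lt)
    where
    cancel : ∀ p q → - p + (p + q) ≡ q
    cancel = solve 2 (λ p q → :- p :+ (p :+ q) := q) refl
      where open +-*-Solver

-- Weighted sums with real weights

weighted : List (ℝ × A) → (A → ℚ) → ℝ
weighted ws q = List.foldr (λ (w , x) s → (q x ·ℝ w) +ℝ s) (fromℚ 0ℚ) ws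

-- Stronger than `fromℚ 0ℚ ≤ℝ x`: it permits termwise estimates with no tolerance, and positive
-- weights have it.
Nonnegativeℝ : ℝ → Set
Nonnegativeℝ x = ∃[ N ] ∀ i → N ℕ.≤ i → 0ℚ ≤ℚ seq x i

positive⇒nonnegative : ∀ x → Positiveℝ x → Nonnegativeℝ x
positive⇒nonnegative x (ε , 0<ε , N , ε≤) = N , λ i N≤i → ≤-trans (<⇒≤ 0<ε) (ε≤ i N≤i)

*-nonneg : 0ℚ ≤ℚ p → 0ℚ ≤ℚ q → 0ℚ ≤ℚ p * q
*-nonneg {p} {q} 0≤p 0≤q =
  subst (_≤ℚ p * q) (*-zeroʳ p) (*-monoˡ-≤-nonNeg p {{nonNegative 0≤p}} 0≤q)

shrink : ∀ p ε → 0ℚ ≤ℚ p → 0ℚ < ε → ∃[ δ ] 0ℚ < δ × p * δ ≤ℚ ε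
shrink p ε 0≤p 0<ε = 1/ c * ε , 0<δ , (begin
  p * (1/ c * ε)   ≤⟨ *-monoʳ-≤-nonNeg (1/ c * ε) {{nonNegative (<⇒≤ 0<δ)}} p≤c ⟩
  c * (1/ c * ε)   ≡⟨ *-assoc c (1/ c) ε ⟨
  c * 1/ c * ε     ≡⟨ cong (_* ε) (*-inverseʳ c) ⟩
  1ℚ * ε           ≡⟨ *-identityˡ ε ⟩
  ε                ∎)
  where
  open ≤-Reasoning
  -- Dividing by `p + 1ℚ` instead of `p` covers `p = 0` as well.
  c = p + 1ℚ
  p≤c : p ≤ℚ c
  p≤c = subst (_≤ℚ c) (+-identityʳ p) (+-monoʳ-≤ p (nonNegative⁻¹ 1ℚ))
  instance
    c-pos : Positive c
    c-pos = positive (+-mono-≤-< 0≤p (positive⁻¹ 1ℚ))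
    c-nonZero = pos⇒nonZero c
    1/c-pos = 1/pos⇒pos c
  0<δ : 0ℚ < 1/ c * ε
  0<δ = subst (_< 1/ c * ε) (*-zeroʳ (1/ c)) (*-monoʳ-<-pos (1/ c) 0<ε)

½*p+½*p : ∀ p → ½ * p + ½ * p ≡ p
½*p+½*p p = trans (sym (*-distribʳ-+ p ½ ½)) (*-identityˡ p)

½*-pos : 0ℚ < p → 0ℚ < ½ * p
½*-pos {p} 0<p = subst (_< ½ * p) (*-zeroʳ ½) (*-monoʳ-<-pos ½ 0<p)

+ℝ-mono-≤ : ∀ {x x′ y y′} → x ≤ℝ x′ → y ≤ℝ y′ → x +ℝ y ≤ℝ x′ +ℝ y′
+ℝ-mono-≤ {x} {x′} {y} {y′} x≤x′ y≤y′ ε 0<ε =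
  let (M , p) = x≤x′ (½ * ε) (½*-pos 0<ε)
      (N , q) = y≤y′ (½ * ε) (½*-pos 0<ε)
  in M ⊔ N , λ i i≥ → begin
     seq x i + seq y i                            ≤⟨ +-mono-≤ (p i (ℕ.m⊔n≤o⇒m≤o M N i≥)) (q i (ℕ.m⊔n≤o⇒n≤o M N i≥)) ⟩
     (seq x′ i + ½ * ε) + (seq y′ i + ½ * ε)      ≡⟨ interchange (seq x′ i) (½ * ε) (seq y′ i) (½ * ε) ⟩
     (seq x′ i + seq y′ i) + (½ * ε + ½ * ε)      ≡⟨ cong (λ z → (seq x′ i + seq y′ i) + z) (½*p+½*p ε) ⟩
     (seq x′ i + seq y′ i) + ε                    ∎
  where open ≤-Reasoning

·ℝ-mono-≤ : ∀ {x y} p → 0ℚ ≤ℚ p → x ≤ℝ y → p ·ℝ x ≤ℝ p ·ℝ y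
·ℝ-mono-≤ {x} {y} p 0≤p x≤y ε 0<ε =
  let (δ , 0<δ , pδ≤ε) = shrink p ε 0≤p 0<ε
      (N , le) = x≤y δ 0<δ
  in N , λ i i≥ → begin
     p * seq x i             ≤⟨ *-monoˡ-≤-nonNeg p {{nonNegative 0≤p}} (le i i≥) ⟩
     p * (seq y i + δ)       ≡⟨ *-distribˡ-+ p (seq y i) δ ⟩
     p * seq y i + p * δ     ≤⟨ +-monoʳ-≤ (p * seq y i) pδ≤ε ⟩
     p * seq y i + ε         ∎
  where open ≤-Reasoning

-- Termwise equality stands in for equality of reals: two numbers with the same terms may carry
-- different `cauchy` proofs.
≤ℝ-respˡ : ∀ {x x′ y} → (∀ i → seq x i ≡ seq x′ i) → x ≤ℝ y → x′ ≤ℝ y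
≤ℝ-respˡ {y = y} x≡x′ x≤y ε 0<ε =
  let (N , le) = x≤y ε 0<ε in N , λ i i≥ → subst (_≤ℚ seq y i + ε) (x≡x′ i) (le i i≥)

≤ℝ-respʳ : ∀ {x y y′} → (∀ i → seq y i ≡ seq y′ i) → x ≤ℝ y → x ≤ℝ y′
≤ℝ-respʳ {x} y≡y′ x≤y ε 0<ε =
  let (N , le) = x≤y ε 0<ε in N , λ i i≥ → subst (λ z → seq x i ≤ℚ z + ε) (y≡y′ i) (le i i≥)

infix 4 _≤ᵉ_

_≤ᵉ_ : ℝ → ℝ → Set
x ≤ᵉ y = ∃[ N ] ∀ i → N ℕ.≤ i → seq x i ≤ℚ seq y i

≤ᵉ-≤ℝ-trans : ∀ {x y z} → x ≤ᵉ y → y ≤ℝ z → x ≤ℝ z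
≤ᵉ-≤ℝ-trans (M , x≤y) y≤z ε 0<ε =
  let (N , le) = y≤z ε 0<ε
  in M ⊔ N , λ i i≥ → ≤-trans (x≤y i (ℕ.m⊔n≤o⇒m≤o M N i≥)) (le i (ℕ.m⊔n≤o⇒n≤o M N i≥))

private
  linear : ∀ p q w s t → (p * w + s) + (q * w + t) ≡ (p + q) * w + (s + t)
  linear = solve 5 (λ p q w s t → (p :* w :+ s) :+ (q :* w :+ t) := (p :+ q) :* w :+ (s :+ t)) refl
    where open +-*-Solver

weighted-+ : ∀ (ws : List (ℝ × A)) p q i →
             seq (weighted ws p) i + seq (weighted ws q) i ≡ seq (weighted ws (λ x → p x + q x)) i
weighted-+ []             p q i = refl
weighted-+ ((w , x) ∷ ws) p q i =
  trans (linear (p x) (q x) (seq w i) (seq (weighted ws p) i) (seq (weighted ws q) i))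
        (cong (λ z → (p x + q x) * seq w i + z) (weighted-+ ws p q i))

weighted-* : ∀ (ws : List (ℝ × A)) p q i →
             p * seq (weighted ws q) i ≡ seq (weighted ws (λ x → p * q x)) i
weighted-* []             p q i = *-zeroʳ p
weighted-* ((w , x) ∷ ws) p q i =
  trans (*-distribˡ-+ p (q x * seq w i) (seq (weighted ws q) i))
        (cong₂ _+_ (sym (*-assoc p (q x) (seq w i))) (weighted-* ws p q i))

weighted-nonneg : {ws : List (ℝ × A)} {q : A → ℚ} → All (Positiveℝ ∘ proj₁) ws →
                  All (λ (_ , x) → 0ℚ ≤ℚ q x) ws → Nonnegativeℝ (weighted ws q)
weighted-nonneg [] [] = 0 , λ _ _ → ≤-refl
weighted-nonneg {ws = (w , _) ∷ _} (w-pos ∷ ws-pos) (0≤q ∷ 0≤qs) =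
  let (M , 0≤w) = positive⇒nonnegative w w-pos
      (N , 0≤s) = weighted-nonneg ws-pos 0≤qs
  in M ⊔ N , λ i i≥ → +-mono-≤ (*-nonneg 0≤q (0≤w i (ℕ.m⊔n≤o⇒m≤o M N i≥))) (0≤s i (ℕ.m⊔n≤o⇒n≤o M N i≥))

-- The first weight is eventually at least some `η` above 0, so a positive value there would keep
-- the whole sum at `q x * η` or more, the other terms being nonnegative. Dropping the first term,
-- nonnegative too, leaves a sum that is still at most 0.
weighted-zero : {ws : List (ℝ × A)} {q : A → ℚ} → All (Positiveℝ ∘ proj₁) ws →
                All (λ (_ , x) → 0ℚ ≤ℚ q x) ws → weighted ws q ≤ℝ fromℚ 0ℚ →
                All (λ (_ , x) → q x ≤ℚ 0ℚ) ws
weighted-zero [] [] _ = []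
weighted-zero {A = A} {ws = (w , x) ∷ ws} {q} (w-pos@(η , 0<η , L , η≤w) ∷ ws-pos) (0≤q ∷ 0≤qs) ≤0 =
  ≮⇒≥ ¬0<q ∷ weighted-zero ws-pos 0≤qs rest≤0
  where
  open ≤-Reasoning
  rest = weighted ws q
  rest≤0 : rest ≤ℝ fromℚ 0ℚ
  rest≤0 ε 0<ε =
    let (M , 0≤w) = positive⇒nonnegative w w-pos
        (N , le) = ≤0 ε 0<ε
    in M ⊔ N , λ i i≥ → begin
       seq rest i                    ≡⟨ +-identityˡ (seq rest i) ⟨
       0ℚ + seq rest i               ≤⟨ +-monoˡ-≤ (seq rest i) (*-nonneg 0≤q (0≤w i (ℕ.m⊔n≤o⇒m≤o M N i≥))) ⟩
       q x * seq w i + seq rest i    ≤⟨ le i (ℕ.m⊔n≤o⇒n≤o M N i≥) ⟩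
       0ℚ + ε                        ∎
  ¬0<q : ¬ 0ℚ < q x
  ¬0<q 0<q =
    let (M , 0≤s) = weighted-nonneg {q = q} ws-pos 0≤qs
        -- A tolerance of half the lower bound `q x * η` leaves a strict gap.
        (N , le) = ≤0 (½ * (q x * η)) (½*-pos 0<qη)
        i = L ⊔ (M ⊔ N)
        i≥M⊔N = ℕ.m≤n⊔m L (M ⊔ N)
    in <-irrefl refl (begin-strict
       q x * η                       ≤⟨ *-monoˡ-≤-nonNeg (q x) {{nonNegative 0≤q}} (η≤w i (ℕ.m≤m⊔n L (M ⊔ N))) ⟩
       q x * seq w i                 ≡⟨ +-identityʳ (q x * seq w i) ⟨
       q x * seq w i + 0ℚ            ≤⟨ +-monoʳ-≤ (q x * seq w i) (0≤s i (ℕ.m⊔n≤o⇒m≤o M N i≥M⊔N)) ⟩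
       q x * seq w i + seq rest i    ≤⟨ le i (ℕ.m⊔n≤o⇒n≤o M N i≥M⊔N) ⟩
       0ℚ + ½ * (q x * η)            <⟨ +-monoˡ-< (½ * (q x * η)) (½*-pos 0<qη) ⟩
       ½ * (q x * η) + ½ * (q x * η) ≡⟨ ½*p+½*p (q x * η) ⟩
       q x * η                       ∎)
    where
    0<qη : 0ℚ < q x * η
    0<qη = subst (_< q x * η) (*-zeroʳ (q x)) (*-monoʳ-<-pos (q x) {{positive 0<q}} 0<η)

total : List (ℝ × A) → ℝ
total ws = List.foldr (λ (w , _) s → w +ℝ s) (fromℚ 0ℚ) ws

weighted-const-seq : ∀ (ws : List (ℝ × A)) t q → (∀ x → t ≡ q x) → ∀ i →
                     t * seq (total ws) i ≡ seq (weighted ws q) i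
weighted-const-seq []             t q t≡q i = *-zeroʳ t
weighted-const-seq ((w , x) ∷ ws) t q t≡q i =
  trans (*-distribˡ-+ t (seq w i) (seq (total ws) i))
        (cong₂ _+_ (cong (_* seq w i) (t≡q x)) (weighted-const-seq ws t q t≡q i))

scaled-const : ∀ x t → x ≈ℝ fromℚ 1ℚ → t ·ℝ x ≤ℝ fromℚ t
scaled-const x t (x≤1 , 1≤x) ε 0<ε with ≤-total 0ℚ t
... | inj₁ 0≤t =
  let (N , le) = ·ℝ-mono-≤ {x} {fromℚ 1ℚ} t 0≤t x≤1 ε 0<ε
  in N , λ i i≥ → subst (λ z → t * seq x i ≤ℚ z + ε) (*-identityʳ t) (le i i≥)
-- Multiplication by a negative `t` reverses the order, so the bound `1 ≤ x` is multiplied by `- t`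
-- and rearranged.
... | inj₂ t≤0 =
  let (N , le) = ·ℝ-mono-≤ {fromℚ 1ℚ} {x} (- t) (neg-antimono-≤ t≤0) 1≤x ε 0<ε
  in N , λ i i≥ → negate (seq x i) (le i i≥)
  where
  rearrange₁ : ∀ t w → - t + (t * w + t) ≡ t * w
  rearrange₁ = solve 2 (λ t w → :- t :+ (t :* w :+ t) := t :* w) refl
    where open +-*-Solver
  rearrange₂ : ∀ t w ε → (- t * w + ε) + (t * w + t) ≡ t + ε
  rearrange₂ = solve 3 (λ t w ε → (:- t :* w :+ ε) :+ (t :* w :+ t) := t :+ ε) refl
    where open +-*-Solver
  negate : ∀ w → - t * 1ℚ ≤ℚ - t * w + ε → t * w ≤ℚ t + ε
  negate w le = subst₂ _≤ℚ_ (trans (cong (_+ (t * w + t)) (*-identityʳ (- t))) (rearrange₁ t w)) (rearrange₂ t w ε) (+-monoˡ-≤ (t * w + t) le)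

weighted-const : ∀ (ρ : Distribution A B) t → weighted (atoms ρ) (λ _ → t) ≤ℝ fromℚ t
weighted-const ρ t =
  ≤ℝ-respˡ {t ·ℝ total (atoms ρ)} {weighted (atoms ρ) (λ _ → t)} {fromℚ t}
    (weighted-const-seq (atoms ρ) t (λ _ → t) (λ _ → refl)) (scaled-const (total (atoms ρ)) t (weights-total ρ))

-- Costs with value ∞ and bounds on their mean.

infix 4 _≤∞?_

_≤∞?_ : ∀ (u v : ℚ ⁺) → Dec (u ≤∞ v)
_≤∞?_ = NonStrict.≤⁺-dec _≤ℚ_ _≤?_

≤∞-refl : ∀ {u} → u ≤∞ u
≤∞-refl {[ _ ]} = finite≤ ≤-refl
≤∞-refl {⊤⁺}    = ⊤⁺ ≤⊤⁺

≤∞-reflexive : ∀ {u v} → u ≡ v → u ≤∞ v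
≤∞-reflexive refl = ≤∞-refl

≤∞-trans : ∀ {u v w} → u ≤∞ v → v ≤∞ w → u ≤∞ w
≤∞-trans = NonStrict.≤⁺-trans _≤ℚ_ ≤-trans

≤∞-antisym : ∀ {u v} → u ≤∞ v → v ≤∞ u → u ≡ v
≤∞-antisym = NonStrict.≤⁺-antisym-≡ _≤ℚ_ ≤-antisym

finite-below : ∀ {u} → u ≤∞ [ q ] → ∃[ p ] u ≡ [ p ] × p ≤ℚ q
finite-below (finite≤ p≤q) = _ , refl , p≤q

+∞-mono-≤ : ∀ {u v} → u ≤∞ [ p ] → v ≤∞ [ q ] → u +∞ v ≤∞ [ p + q ]
+∞-mono-≤ (finite≤ u≤p) (finite≤ v≤q) = finite≤ (+-mono-≤ u≤p v≤q)

sum∞ : Vec (ℚ ⁺) n → ℚ ⁺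
sum∞ = Vec.foldr′ _+∞_ [ 0ℚ ]

sum∞-split : ∀ (F : Fin n → ℚ ⁺) → sum∞ (tabulate F) ≤∞ [ q ] →
             ∃[ s ] (∀ i → F i ≡ [ s i ]) × sum s ≤ℚ q
sum∞-split {zero}  F (finite≤ 0≤q) = (λ ()) , (λ ()) , 0≤q
sum∞-split {suc n} {q} F le
  with F zero in F₀≡ | sum∞ (tabulate (F ∘ suc)) in F₊≡ | le
... | [ s₀ ] | [ t ] | finite≤ s₀+t≤q =
  let (s , F≡s , Σs≤t) = sum∞-split (F ∘ suc) (≤∞-reflexive F₊≡)
  in (λ { zero → s₀ ; (suc i) → s i })
   , (λ { zero → F₀≡ ; (suc i) → F≡s i })
   , ≤-trans (+-monoʳ-≤ s₀ Σs≤t) s₀+t≤q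

sum∞-finite : ∀ (vs : Vec (ℚ ⁺) n) (s : Fin n → ℚ) → (∀ i → lookup vs i ≡ [ s i ]) → sum∞ vs ≡ [ sum s ]
sum∞-finite []       s vs≡s = refl
sum∞-finite (v ∷ vs) s vs≡s rewrite vs≡s zero | sum∞-finite vs (s ∘ suc) (vs≡s ∘ suc) = refl

mean-finite : ∀ (vs : Vec (ℚ ⁺) (suc n)) (s : Fin (suc n) → ℚ) → (∀ i → lookup vs i ≡ [ s i ]) → mean vs ≡ [ average s ]
mean-finite {n} vs s vs≡s = cong (Maybe.map (+ 1 / suc n *_)) (sum∞-finite vs s vs≡s)

-- Bounding F by rationals instead of using its expectation avoids sums with ∞
-- and makes the notion stable under minimization.
record MeanAtMost {A : Set a} {B : Set b} (ρ : Distribution A B) (F : (A → B) → ℚ ⁺) (c : ℚ) : Set (a Level.⊔ b) where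
  constructor mean-at-most
  field
    upper          : (A → B) → ℚ
    F≤upper        : All (λ (_ , g) → F g ≤∞ [ upper g ]) (atoms ρ)
    weighted-upper : weighted (atoms ρ) upper ≤ℝ fromℚ c

private
  -- The fold inside `expectation`, on a bare list: a tail of `atoms ρ` is no distribution, so
  -- induction has to take place here.
  expect : List (ℝ × A) → (A → ℚ ⁺) → ℝ ⁺
  expect ws F = List.foldr (λ (w , x) s → Maybe.zipWith _+ℝ_ (Maybe.map (_·ℝ w) (F x)) s) [ fromℚ 0ℚ ] ws

-- The default 0 at `⊤⁺` only makes this total; the inequalities derived from it concern costs known
-- to be finite.
value : ℚ ⁺ → ℚ
value = Maybe.fromMaybe 0ℚ

expect-step : ℝ → ℚ ⁺ → ℝ ⁺ → ℝ ⁺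
expect-step w u v = Maybe.zipWith _+ℝ_ (Maybe.map (_·ℝ w) u) v

expect-step-finite : ∀ w u v {x} → expect-step w u v ≡ [ x ] →
                     ∃[ q ] ∃[ y ] u ≡ [ q ] × v ≡ [ y ] × (∀ i → seq x i ≡ q * seq w i + seq y i)
expect-step-finite w [ q ] [ y ] refl = q , y , refl , refl , λ _ → refl

expect-finite : ∀ (ws : List (ℝ × A)) F q → (∀ {a p} → F a ≡ [ p ] → p ≡ q a) → ∀ {x} → expect ws F ≡ [ x ] →
                All (λ (_ , a) → F a ≡ [ q a ]) ws × (∀ i → seq x i ≡ seq (weighted ws q) i)
expect-finite []             F q F≡q refl = [] , λ _ → refl
expect-finite ((w , a) ∷ ws) F q F≡q eq =
  let (p , y , Fa≡p , ws≡y , x≡) = expect-step-finite w (F a) (expect ws F) eq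
      (finite , y≡) = expect-finite ws F q F≡q ws≡y
  in trans Fa≡p (cong [_] (F≡q Fa≡p)) ∷ finite ,
     λ i → trans (x≡ i) (cong₂ _+_ (cong (_* seq w i) (F≡q Fa≡p)) (y≡ i))

expectation⇒MeanAtMost : ∀ (ρ : Distribution A B) F {c} → expectation ρ F ≤ℝ∞ [ fromℚ c ] → MeanAtMost ρ F c
expectation⇒MeanAtMost {A = A} {B = B} ρ F {c} le = bound (expectation ρ F) refl le
  where
  F̂ : (A → B) → ℚ
  F̂ = value ∘ F
  F≡F̂ : ∀ {g p} → F g ≡ [ p ] → p ≡ F̂ g
  F≡F̂ F≡p = cong value (sym F≡p)
  bound : ∀ u → expectation ρ F ≡ u → u ≤ℝ∞ [ fromℚ c ] → MeanAtMost ρ F c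
  bound [ x ] eq (finite≤ x≤c) =
    let (finite , x≡) = expect-finite (atoms ρ) F F̂ F≡F̂ eq
    in mean-at-most F̂ (All.map ≤∞-reflexive finite)
       (≤ℝ-respˡ {x} {weighted (atoms ρ) F̂} {fromℚ c} x≡ x≤c)

expect-step-below : ∀ w u v {y} → u ≤∞ [ q ] → v ≡ [ y ] →
                    ∃[ x ] expect-step w u v ≡ [ x ] × ∃[ p ] p ≤ℚ q × (∀ i → seq x i ≡ p * seq w i + seq y i)
expect-step-below w [ p ] [ y ] (finite≤ p≤q) refl = _ , refl , p , p≤q , λ _ → refl

expect-mono : {ws : List (ℝ × A)} → All (Positiveℝ ∘ proj₁) ws → ∀ F q → All (λ (_ , a) → F a ≤∞ [ q a ]) ws →
              ∃[ x ] expect ws F ≡ [ x ] × x ≤ᵉ weighted ws q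
expect-mono [] F q [] = fromℚ 0ℚ , refl , 0 , λ _ _ → ≤-refl
expect-mono {ws = (w , a) ∷ ws} (w-pos ∷ ws-pos) F q (F≤q ∷ Fs≤q) =
  let (y , ws≡y , N , y≤) = expect-mono ws-pos F q Fs≤q
      (x , x≡ , p , p≤q , xᵢ≡) = expect-step-below w (F a) (expect ws F) F≤q ws≡y
      (M , 0≤w) = positive⇒nonnegative w w-pos
  in x , x≡ , M ⊔ N , λ i i≥ →
     subst (_≤ℚ q a * seq w i + seq (weighted ws q) i) (sym (xᵢ≡ i))
       (+-mono-≤ (*-monoʳ-≤-nonNeg (seq w i) {{nonNegative (0≤w i (ℕ.m⊔n≤o⇒m≤o M N i≥))}} p≤q)
                 (y≤ i (ℕ.m⊔n≤o⇒n≤o M N i≥)))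

MeanAtMost⇒expectation : ∀ (ρ : Distribution A B) F {c} → MeanAtMost ρ F c → expectation ρ F ≤ℝ∞ [ fromℚ c ]
MeanAtMost⇒expectation ρ F {c} (mean-at-most q F≤q Eq≤c) =
  let (x , eq , x≤) = expect-mono (weights-positive ρ) F q F≤q
  in subst (_≤ℝ∞ [ fromℚ c ]) (sym eq) (finite≤ (≤ᵉ-≤ℝ-trans {x} {weighted (atoms ρ) q} {fromℚ c} x≤ Eq≤c))

module _ (ρ : Distribution A B) where

  MeanAtMost-mono : ∀ {F G c} → (∀ g → F g ≤∞ G g) → MeanAtMost ρ G c → MeanAtMost ρ F c
  MeanAtMost-mono F≤G (mean-at-most q G≤q Eq≤c) = mean-at-most q (All.map (λ {(_ , g)} → ≤∞-trans (F≤G g)) G≤q) Eq≤c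

  MeanAtMost-+ : ∀ {F G c d} → MeanAtMost ρ F c → MeanAtMost ρ G d → MeanAtMost ρ (λ g → F g +∞ G g) (c + d)
  MeanAtMost-+ {c = c} {d} (mean-at-most p F≤p Ep≤c) (mean-at-most q G≤q Eq≤d) =
    mean-at-most (λ g → p g + q g) (All.zipWith (λ (F≤p , G≤q) → +∞-mono-≤ F≤p G≤q) (F≤p , G≤q))
    (≤ℝ-respˡ {weighted (atoms ρ) p +ℝ weighted (atoms ρ) q} {weighted (atoms ρ) (λ g → p g + q g)} {fromℚ (c + d)}
      (weighted-+ (atoms ρ) p q)
      (+ℝ-mono-≤ {weighted (atoms ρ) p} {fromℚ c} {weighted (atoms ρ) q} {fromℚ d} Ep≤c Eq≤d))

  MeanAtMost-0 : MeanAtMost ρ (const [ 0ℚ ]) 0ℚ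
  MeanAtMost-0 = mean-at-most (λ _ → 0ℚ) (All.universal (λ _ → ≤∞-refl) (atoms ρ)) (weighted-const ρ 0ℚ)

  MeanAtMost-sum : ∀ (F : Fin n → (A → B) → ℚ ⁺) (c : Fin n → ℚ) → (∀ i → MeanAtMost ρ (F i) (c i)) →
                   MeanAtMost ρ (λ g → sum∞ (tabulate (λ i → F i g))) (sum c)
  MeanAtMost-sum {n = zero}  F c F≤c = MeanAtMost-0
  MeanAtMost-sum {n = suc n} F c F≤c =
    MeanAtMost-+ (F≤c zero) (MeanAtMost-sum (F ∘ suc) (c ∘ suc) (F≤c ∘ suc))

  MeanAtMost-* : ∀ p {F c} → 0ℚ ≤ℚ p → MeanAtMost ρ F c → MeanAtMost ρ (λ g → Maybe.map (p *_) (F g)) (p * c)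
  MeanAtMost-* p {F} {c} 0≤p (mean-at-most q F≤q Eq≤c) =
    mean-at-most (λ g → p * q g) (All.map (λ {(_ , g)} → scale (F g)) F≤q)
    (≤ℝ-respˡ {p ·ℝ weighted (atoms ρ) q} {weighted (atoms ρ) (λ g → p * q g)} {fromℚ (p * c)}
      (weighted-* (atoms ρ) p q)
      (·ℝ-mono-≤ {weighted (atoms ρ) q} {fromℚ c} p 0≤p Eq≤c))
    where
    scale : ∀ u {r} → u ≤∞ [ r ] → Maybe.map (p *_) u ≤∞ [ p * r ]
    scale [ u ] (finite≤ u≤r) = finite≤ (*-monoˡ-≤-nonNeg p {{nonNegative 0≤p}} u≤r)

  MeanAtMost-mean : ∀ (F : Fin (suc n) → (A → B) → ℚ ⁺) (c : Fin (suc n) → ℚ) → (∀ i → MeanAtMost ρ (F i) (c i)) →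
                    MeanAtMost ρ (λ g → mean (tabulate (λ i → F i g))) (average c)
  MeanAtMost-mean {n = n} F c F≤c =
    MeanAtMost-* (+ 1 / suc n) (<⇒≤ (positive⁻¹ (+ 1 / suc n) {{1/suc-pos n}})) (MeanAtMost-sum F c F≤c)

  private
    excess≤0 : ∀ {q : (A → B) → ℚ} {c} → weighted (atoms ρ) q ≤ℝ fromℚ c →
               All (λ (_ , g) → 0ℚ ≤ℚ q g + - c) (atoms ρ) → All (λ (_ , g) → q g ≤ℚ c) (atoms ρ)
    excess≤0 {q} {c} Eq≤c 0≤q-c =
      All.map (λ {(_ , g)} q-c≤0 → subst₂ _≤ℚ_ (cancel (q g) c) (+-identityˡ c) (+-monoˡ-≤ c q-c≤0))
        (weighted-zero {q = λ g → q g + - c} (weights-positive ρ) 0≤q-c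
          (subst (λ z → weighted (atoms ρ) (λ g → q g + - c) ≤ℝ fromℚ z) (+-inverseʳ c)
            (≤ℝ-respˡ {weighted (atoms ρ) q +ℝ weighted (atoms ρ) (λ _ → - c)} {weighted (atoms ρ) (λ g → q g + - c)} {fromℚ (c + - c)}
              (weighted-+ (atoms ρ) q (λ _ → - c))
              (+ℝ-mono-≤ {weighted (atoms ρ) q} {fromℚ c} {weighted (atoms ρ) (λ _ → - c)} {fromℚ (- c)}
                Eq≤c (weighted-const ρ (- c))))))
      where
      cancel : ∀ q c → (q + - c) + c ≡ q
      cancel = solve 2 (λ q c → (q :+ :- c) :+ c := q) refl
        where open +-*-Solver

    0≤difference : ∀ {p q} → p ≤ℚ q → 0ℚ ≤ℚ q + - p
    0≤difference {p} {q} p≤q = subst (_≤ℚ q + - p) (+-inverseʳ p) (+-monoˡ-≤ (- p) p≤q)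

  -- The difference of the upper bound and `c` is nonnegative at every atom and has mean at most 0,
  -- so `weighted-zero` applies. With a minimum as `c`, this says that every operation of the
  -- support keeps minimizers minimal.
  MeanAtMost-tight : ∀ {F c} → MeanAtMost ρ F c → All (λ (_ , g) → [ c ] ≤∞ F g) (atoms ρ) →
                     All (λ (_ , g) → F g ≡ [ c ]) (atoms ρ)
  MeanAtMost-tight {F} {c} (mean-at-most q F≤q Eq≤c) c≤F =
    All.zipWith (λ { ((F≤q , c≤F) , q≤c) → ≤∞-antisym (≤∞-trans F≤q (finite≤ q≤c)) c≤F })
      (All.zip (F≤q , c≤F) ,
       excess≤0 Eq≤c (All.zipWith (λ { (F≤q , c≤F) → 0≤difference (NonStrict.[≤]-injective _≤ℚ_ (≤∞-trans c≤F F≤q)) }) (F≤q , c≤F)))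

  -- The search through the atoms is decidable. Were it to fail, every cost would be at least `c`,
  -- hence equal to `c` by `MeanAtMost-tight`, which is absurd at any atom; and an empty list cannot
  -- have total weight 1.
  MeanAtMost-attained : ∀ {F c} → MeanAtMost ρ F c → Any (λ (_ , g) → F g ≤∞ [ c ]) (atoms ρ)
  MeanAtMost-attained {F} {c} E≤c with Any.any? (λ (_ , g) → F g ≤∞? [ c ]) (atoms ρ)
  ... | yes any  = any
  ... | no  none = ⊥-elim (total-nonempty (weights-total ρ)
    (All.zipWith (λ { (F≰c , F≡c) → F≰c (≤∞-reflexive F≡c) })
      (F≰c , MeanAtMost-tight E≤c (All.map (λ {(_ , g)} → ≰∞⇒≥∞ (F g)) F≰c))))
    where
    F≰c = All.¬Any⇒All¬ (atoms ρ) none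
    ≰∞⇒≥∞ : ∀ u → ¬ u ≤∞ [ c ] → [ c ] ≤∞ u
    ≰∞⇒≥∞ [ u ] u≰c = finite≤ (<⇒≤ (≰⇒> (u≰c ∘ finite≤)))
    ≰∞⇒≥∞ ⊤⁺    _   = _ ≤⊤⁺
    total-nonempty : ∀ {X : Set _} {ws : List (ℝ × X)} → total ws ≈ℝ fromℚ 1ℚ → All (const ⊥) ws → ⊥
    total-nonempty (_ , 1≤0) [] =
      let (N , le) = 1≤0 ½ (positive⁻¹ ½) in from-no (1ℚ ≤? 0ℚ + ½) (le N ℕ.≤-refl)

MeanAtMost-weaken : ∀ (ρ : Distribution A B) {F c d} → c ≤ℚ d → MeanAtMost ρ F c → MeanAtMost ρ F d
MeanAtMost-weaken ρ c≤d (mean-at-most q F≤q Eq≤c) = mean-at-most q F≤q λ ε 0<ε →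
  let (N , le) = Eq≤c ε 0<ε in N , λ i i≥ → ≤-trans (le i i≥) (+-monoˡ-≤ ε c≤d)

-- Replaces a distribution by one good operation that also has a property shared by all atoms.
MeanAtMost-attained-with : ∀ {p} {P : (A → B) → Set p} (ρ : Distribution A B) {F c} → All (λ (_ , g) → P g) (atoms ρ) →
                           MeanAtMost ρ F c → ∃[ g ] P g × F g ≤∞ [ c ]
MeanAtMost-attained-with ρ all E≤c = _ , All.lookupAny all (MeanAtMost-attained ρ E≤c)

-- Operations applied to the columns of a matrix

Vec-ext : {xs ys : Vec A n} → (∀ i → lookup xs i ≡ lookup ys i) → xs ≡ ys
Vec-ext {xs = xs} {ys} eq = trans (sym (tabulate∘lookup xs)) (trans (tabulate-cong eq) (tabulate∘lookup ys))

-- Rows are given by a function, so that omitting one is composition with `punchIn` and adding one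
-- is `insertAt`. `map-transpose` links this to the matrices in the definition of a fractional
-- polymorphism.
column : (Fin k → Vec A n) → Fin n → Vec A k
column X j = tabulate (λ r → lookup (X r) j)

applyRows : (Vec A k → B) → (Fin k → Vec A n) → Vec B n
applyRows g X = tabulate (g ∘ column X)

lookup-applyRows : ∀ (g : Vec A k → B) (X : Fin k → Vec A n) j → lookup (applyRows g X) j ≡ g (column X j)
lookup-applyRows g X j = lookup∘tabulate (g ∘ column X) j

lookup-transpose : ∀ (xs : Vec (Vec A n) k) j → lookup (Vec.transpose xs) j ≡ column (lookup xs) j
lookup-transpose []       j = lookup-replicate j []
lookup-transpose {n = n} (x ∷ xs) j = begin
  lookup ((Vec.replicate n Vec._∷_ Vec.⊛ x) Vec.⊛ Vec.transpose xs) j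
    ≡⟨ lookup-⊛ j (Vec.replicate n Vec._∷_ Vec.⊛ x) (Vec.transpose xs) ⟩
  lookup (Vec.replicate n Vec._∷_ Vec.⊛ x) j (lookup (Vec.transpose xs) j)
    ≡⟨ cong (λ f → f (lookup (Vec.transpose xs) j)) (lookup-⊛ j (Vec.replicate n Vec._∷_) x) ⟩
  lookup (Vec.replicate n Vec._∷_) j (lookup x j) (lookup (Vec.transpose xs) j)
    ≡⟨ cong₂ (λ f ys → f (lookup x j) ys) (lookup-replicate j Vec._∷_) (lookup-transpose xs j) ⟩
  lookup x j ∷ column (lookup xs) j ∎
  where open ≡-Reasoning

map-transpose : ∀ (g : Vec A k → B) (xs : Vec (Vec A n) k) → Vec.map g (Vec.transpose xs) ≡ applyRows g (lookup xs)
map-transpose g xs = Vec-ext λ j → begin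
  lookup (Vec.map g (Vec.transpose xs)) j   ≡⟨ lookup-map j g (Vec.transpose xs) ⟩
  g (lookup (Vec.transpose xs) j)           ≡⟨ cong g (lookup-transpose xs j) ⟩
  g (column (lookup xs) j)                  ≡⟨ lookup-applyRows g (lookup xs) j ⟨
  lookup (applyRows g (lookup xs)) j        ∎
  where open ≡-Reasoning

applyRows-cong : ∀ (g : Vec A k → B) {X Y : Fin k → Vec A n} → (∀ r → X r ≡ Y r) → applyRows g X ≡ applyRows g Y
applyRows-cong g X≡Y = tabulate-cong λ j → cong g (tabulate-cong λ r → cong (λ x → lookup x j) (X≡Y r))

row-coordinatewise : ∀ (g : Map d m) (xs : Vec (Points d n) m) r →
                     lookup (coordinatewise g xs) r ≡ applyRows (λ x → lookup (g x) r) (lookup xs)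
row-coordinatewise g xs r = begin
  lookup (Vec.transpose (Vec.map g (Vec.transpose xs))) r
    ≡⟨ lookup-transpose (Vec.map g (Vec.transpose xs)) r ⟩
  tabulate (λ j → lookup (lookup (Vec.map g (Vec.transpose xs)) j) r)
    ≡⟨ tabulate-cong (λ j → cong (λ ys → lookup (lookup ys j) r) (map-transpose g xs)) ⟩
  tabulate (λ j → lookup (lookup (applyRows g (lookup xs)) j) r)
    ≡⟨ tabulate-cong (λ j → cong (λ y → lookup y r) (lookup-applyRows g (lookup xs) j)) ⟩
  applyRows (λ x → lookup (g x) r) (lookup xs) ∎
  where open ≡-Reasoning

scope-applyRows : ∀ (g : Vec A k → B) (X : Fin k → Vec A n) (is : Vec (Fin n) m) →
                  Vec.map (lookup (applyRows g X)) is ≡ applyRows g (λ r → Vec.map (lookup (X r)) is)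
scope-applyRows g X is = Vec-ext λ j → begin
  lookup (Vec.map (lookup (applyRows g X)) is) j                 ≡⟨ lookup-map j (lookup (applyRows g X)) is ⟩
  lookup (applyRows g X) (lookup is j)                           ≡⟨ lookup-applyRows g X (lookup is j) ⟩
  g (column X (lookup is j))                                     ≡⟨ cong g (tabulate-cong λ r → sym (lookup-map j (lookup (X r)) is)) ⟩
  g (column (λ r → Vec.map (lookup (X r)) is) j)                 ≡⟨ lookup-applyRows g (λ r → Vec.map (lookup (X r)) is) j ⟨
  lookup (applyRows g (λ r → Vec.map (lookup (X r)) is)) j       ∎
  where open ≡-Reasoning

applyRows-++ : ∀ (g : Vec A k → B) (X : Fin k → Vec A m) (Y : Fin k → Vec A n) →
               applyRows g X Vec.++ applyRows g Y ≡ applyRows g (λ r → X r Vec.++ Y r)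
applyRows-++ {m = m} g X Y = Vec-ext λ j → trans (lookup-splitAt m (applyRows g X) (applyRows g Y) j) (trans (go (Fin.splitAt m j))
    (trans (cong g (tabulate-cong λ r → sym (lookup-splitAt m (X r) (Y r) j))) (sym (lookup-applyRows g (λ r → X r Vec.++ Y r) j))))
  where
  go : ∀ s → [ lookup (applyRows g X) , lookup (applyRows g Y) ]′ s ≡ g (tabulate (λ r → [ lookup (X r) , lookup (Y r) ]′ s))
  go (inj₁ i) = lookup-applyRows g X i
  go (inj₂ i) = lookup-applyRows g Y i

-- Fractional polymorphisms acting on objectives and on ⟨Γ⟩.

Improves : Distribution (Points d (suc k)) (Fin d) → CostFunction d n → Set
Improves ν F = ∀ X (c : Fin _ → ℚ) → (∀ r → F (X r) ≤∞ [ c r ]) → MeanAtMost ν (λ g → F (applyRows g X)) (average c)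

power-finite : ∀ (f : CostFunction d n) (xs : Vec (Points d n) (suc m)) v → (∀ r → f (lookup xs r) ≡ [ v r ]) →
               (f power suc m) xs ≡ [ average v ]
power-finite f xs v f≡v = mean-finite (Vec.map f xs) v (λ r → trans (lookup-map r f xs) (f≡v r))

finite⇒dom : ∀ {u : ℚ ⁺} {v} → u ≡ [ v ] → u <∞ ⊤⁺
finite⇒dom refl = Strict.[ _ ]<⊤⁺

dom⇒finite : ∀ {u : ℚ ⁺} → u <∞ ⊤⁺ → ∃[ v ] u ≡ [ v ]
dom⇒finite Strict.[ v ]<⊤⁺ = v , refl

module _ {Γ : Language d ℓ} (ν : Distribution (Points d (suc k)) (Fin d)) (ν-poly : IsFractionalPolymorphism Γ ν) where

  member-improves : (f : CostFunction d n) → Member Γ f → Improves ν f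
  member-improves f f∈Γ X c f≤c =
    MeanAtMost-weaken ν (average-mono-≤ (λ r → proj₂ (proj₂ (finite r))))
      (MeanAtMost-mono ν (λ g → ≤∞-reflexive (cong f (trans (applyRows-cong g (λ r → sym (lookup∘tabulate X r))) (sym (map-transpose g (tabulate X))))))
        (expectation⇒MeanAtMost ν _
          (subst (λ u → expectation ν (λ g → f (Vec.map g (Vec.transpose (tabulate X)))) ≤ℝ∞ Maybe.map fromℚ u)
            (power-finite f (tabulate X) (proj₁ ∘ finite) f≡)
            (ν-poly f f∈Γ (tabulate X) (λ r → finite⇒dom (f≡ r))))))
    where
    finite : ∀ r → ∃[ v ] f (X r) ≡ [ v ] × v ≤ℚ c r
    finite r = finite-below (f≤c r)
    f≡ : ∀ r → f (lookup (tabulate X) r) ≡ [ proj₁ (finite r) ]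
    f≡ r = trans (cong f (lookup∘tabulate X r)) (proj₁ (proj₂ (finite r)))

  objective-improves : (cs : List (Constraint Γ n)) → Improves ν (objective cs)
  objective-improves [] X c 0≤c =
    MeanAtMost-weaken ν (subst (_≤ℚ average c) (average-const k 0ℚ) (average-mono-≤ (λ r → NonStrict.[≤]-injective _≤ℚ_ (0≤c r))))
      (MeanAtMost-0 ν)
  objective-improves (con ∷ cs) X c F≤c =
    MeanAtMost-weaken ν (≤-trans (≤-reflexive (average-+ u v)) (average-mono-≤ (λ r → proj₂ (proj₂ (proj₂ (proj₂ (split r)))))))
      (MeanAtMost-+ ν
        (MeanAtMost-mono ν (λ g → ≤∞-reflexive (cong cost (scope-applyRows g X scope)))
          (member-improves cost member (λ r → Vec.map (lookup (X r)) scope) u (λ r → ≤∞-reflexive (proj₁ (proj₂ (proj₂ (split r)))))))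
        (objective-improves cs X v (λ r → ≤∞-reflexive (proj₁ (proj₂ (proj₂ (proj₂ (split r))))))))
    where
    open Constraint con
    +∞-split : ∀ u v {q} → u +∞ v ≤∞ [ q ] → ∃[ a ] ∃[ b ] u ≡ [ a ] × v ≡ [ b ] × a + b ≤ℚ q
    +∞-split [ a ] [ b ] (finite≤ a+b≤q) = a , b , refl , refl , a+b≤q
    split : ∀ r → ∃[ a ] ∃[ b ] cost (Vec.map (lookup (X r)) scope) ≡ [ a ] × objective cs (X r) ≡ [ b ] × a + b ≤ℚ c r
    split r = +∞-split _ _ (F≤c r)
    u v : Fin (suc k) → ℚ
    u = proj₁ ∘ split
    v = proj₁ ∘ proj₂ ∘ split

  -- Each row is extended by an optimal choice of the minimized variables. The operation applied to
  -- the extended rows yields one extension of the image row, and the objective there bounds `f`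
  -- from above.
  ⟨⟩-improves : (f : CostFunction d m) → ⟨ Γ ⟩ f → Improves ν f
  ⟨⟩-improves f (l , cs , minimal) X c f≤c =
    MeanAtMost-mono ν (λ g → subst (λ z → f (applyRows g X) ≤∞ objective cs z) (applyRows-++ g X Y) (proj₁ (minimal (applyRows g X)) (applyRows g Y)))
      (objective-improves cs (λ r → X r Vec.++ Y r) c (λ r → subst (_≤∞ [ c r ]) (proj₂ (proj₂ (minimal (X r)))) (f≤c r)))
    where
    Y : Fin (suc k) → Points d l
    Y r = proj₁ (proj₂ (minimal (X r)))

-- Generalized fractional polymorphisms that maximality puts below ω.

All-atoms⇒supp : ∀ {p} {P : (A → B) → Set p} (ρ : Distribution A B) → (∀ g → g ∈ supp ρ → P g) → All (λ (_ , g) → P g) (atoms ρ)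
All-atoms⇒supp ρ P-supp = All.tabulate λ {(_ , g)} g∈ρ → P-supp g (Any.map (λ { refl _ → refl }) g∈ρ)

relabel : (A → B) → List (ℝ × A) → List (ℝ × B)
relabel Φ = List.map (λ (w , a) → w , Φ a)

total-relabel : ∀ (Φ : A → B) ws i → seq (total ws) i ≡ seq (total (relabel Φ ws)) i
total-relabel Φ []             i = refl
total-relabel Φ ((w , a) ∷ ws) i = cong (λ z → seq w i + z) (total-relabel Φ ws i)

weighted-relabel-≤ : ∀ (Φ : A → B) {ws} p q → All (Positiveℝ ∘ proj₁) ws → All (λ (_ , a) → p (Φ a) ≤ℚ q a) ws →
                     weighted (relabel Φ ws) p ≤ᵉ weighted ws q
weighted-relabel-≤ Φ p q [] [] = 0 , λ _ _ → ≤-refl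
weighted-relabel-≤ Φ {(w , a) ∷ ws} p q (w-pos ∷ ws-pos) (p≤q ∷ ps≤q) =
  let (M , 0≤w) = positive⇒nonnegative w w-pos
      (N , s≤t) = weighted-relabel-≤ Φ p q ws-pos ps≤q
  in M ⊔ N , λ i i≥ →
     +-mono-≤ (*-monoʳ-≤-nonNeg (seq w i) {{nonNegative (0≤w i (ℕ.m⊔n≤o⇒m≤o M N i≥))}} p≤q)
              (s≤t i (ℕ.m⊔n≤o⇒n≤o M N i≥))

pushforward : ∀ {a′ b′} {A′ : Set a′} {B′ : Set b′} → ((A → B) → A′ → B′) → Distribution A B → Distribution A′ B′
pushforward Φ ρ .atoms            = relabel Φ (atoms ρ)
pushforward Φ ρ .weights-positive = All.map⁺ (weights-positive ρ)
pushforward Φ ρ .weights-total    =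
  ≤ℝ-respˡ {total (atoms ρ)} {total (relabel Φ (atoms ρ))} {fromℚ 1ℚ} (total-relabel Φ (atoms ρ)) (proj₁ (weights-total ρ)) ,
  ≤ℝ-respʳ {fromℚ 1ℚ} {total (atoms ρ)} {total (relabel Φ (atoms ρ))} (total-relabel Φ (atoms ρ)) (proj₂ (weights-total ρ))

-- Two atoms with the same image under `Φ` may have different upper bounds, so the bound chosen for
-- the image is the cost itself.
MeanAtMost-pushforward : ∀ {a′ b′} {A′ : Set a′} {B′ : Set b′} (Φ : (A → B) → A′ → B′) ρ F {c} →
                         MeanAtMost ρ (F ∘ Φ) c → MeanAtMost (pushforward Φ ρ) F c
MeanAtMost-pushforward Φ ρ F {c} (mean-at-most q F≤q Eq≤c) =
  mean-at-most (value ∘ F)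
    (All.map⁺ (All.map (λ F≤q → let (_ , eq , _) = finite-below F≤q in ≤∞-reflexive (trans eq (cong (λ u → [ value u ]) (sym eq)))) F≤q))
    (≤ᵉ-≤ℝ-trans {weighted (relabel Φ (atoms ρ)) (value ∘ F)} {weighted (atoms ρ) q} {fromℚ c}
      (weighted-relabel-≤ Φ (value ∘ F) q (weights-positive ρ) (All.map value-≤ F≤q))
      Eq≤c)
  where
  value-≤ : ∀ {u q} → u ≤∞ [ q ] → value u ≤ℚ q
  value-≤ (finite≤ u≤q) = u≤q

lookup-permute : ∀ (π : Permutation′ n) (x : Vec A n) i → lookup (permute π x) i ≡ lookup x (π ⟨$⟩ʳ i)
lookup-permute π x i = lookup∘tabulate (λ i → lookup x (π ⟨$⟩ʳ i)) i

Ω-resp-≗ : {g h : Map d m} → g ≗ h → Ω h → Ω g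
Ω-resp-≗ g≗h h∈Ω π x = trans (cong (permute π) (g≗h x)) (trans (h∈Ω π x) (sym (g≗h (permute π x))))

leaveOneOut : (Vec A k → A) → Vec A (suc k) → Vec A (suc k)
leaveOneOut g x = tabulate λ r → g (tabulate λ s → lookup x (punchIn r s))

lookup-leaveOneOut : ∀ (g : Vec A k → A) x r → lookup (leaveOneOut g x) r ≡ g (tabulate λ s → lookup x (punchIn r s))
lookup-leaveOneOut g x r = lookup∘tabulate (λ r → g (tabulate λ s → lookup x (punchIn r s))) r

SymmetricOp : (Vec A k → B) → Set _
SymmetricOp g = ∀ π x → g (permute π x) ≡ g x

-- Both sides list the entries of `x` other than the one at `π r`; the orders differ by the
-- permutation `remove r π`, to which `g` is blind. It serves twice: for membership in `Ω`, and with
-- a transposition for column `j` of the rows.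
symmetric-omit : ∀ {g : Vec A k → B} → SymmetricOp g → ∀ (π : Permutation′ (suc k)) (x : Fin (suc k) → A) r →
                 g (tabulate λ s → x (π ⟨$⟩ʳ punchIn r s)) ≡ g (tabulate λ s → x (punchIn (π ⟨$⟩ʳ r) s))
symmetric-omit {g = g} g-sym π x r = begin
  g (tabulate λ s → x (π ⟨$⟩ʳ punchIn r s))
    ≡⟨ cong g (tabulate-cong λ s → trans (cong x (punchIn-permute π r s)) (sym (lookup∘tabulate (λ s → x (punchIn (π ⟨$⟩ʳ r) s)) (remove r π ⟨$⟩ʳ s)))) ⟩
  g (permute (remove r π) (tabulate λ s → x (punchIn (π ⟨$⟩ʳ r) s)))
    ≡⟨ g-sym (remove r π) _ ⟩
  g (tabulate λ s → x (punchIn (π ⟨$⟩ʳ r) s)) ∎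
  where open ≡-Reasoning

leaveOneOut-Ω : ∀ {g : Points d k → Fin d} → SymmetricOp g → Ω (leaveOneOut g)
leaveOneOut-Ω {g = g} g-sym π x = tabulate-cong λ r → begin
  lookup (leaveOneOut g x) (π ⟨$⟩ʳ r)                            ≡⟨ lookup-leaveOneOut g x (π ⟨$⟩ʳ r) ⟩
  g (tabulate λ s → lookup x (punchIn (π ⟨$⟩ʳ r) s))             ≡⟨ symmetric-omit g-sym π (lookup x) r ⟨
  g (tabulate λ s → lookup x (π ⟨$⟩ʳ punchIn r s))               ≡⟨ cong g (tabulate-cong λ s → sym (lookup-permute π x (punchIn r s))) ⟩
  g (tabulate λ s → lookup (permute π x) (punchIn r s))          ∎
  where open ≡-Reasoning

row-leaveOneOut : ∀ (g : Points d k → Fin d) (xs : Vec (Points d n) (suc k)) r →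
                  lookup (coordinatewise (leaveOneOut g) xs) r ≡ applyRows g (λ s → lookup xs (punchIn r s))
row-leaveOneOut g xs r = trans (row-coordinatewise (leaveOneOut g) xs r) (tabulate-cong λ j →
  trans (lookup-leaveOneOut g (column (lookup xs) j) r) (cong g (tabulate-cong λ s → lookup∘tabulate (λ r → lookup (lookup xs r) j) (punchIn r s))))

power-tabulate : ∀ (f : CostFunction d n) (xs : Vec (Points d n) m) F → (∀ r → f (lookup xs r) ≡ F r) →
                 (f power m) xs ≡ mean (tabulate F)
power-tabulate f xs F f≡F = cong mean (Vec-ext {xs = Vec.map f xs} {tabulate F} λ r →
  trans (lookup-map r f xs) (trans (f≡F r) (sym (lookup∘tabulate F r))))

power-cong : ∀ (f : CostFunction d n) (xs ys : Vec (Points d n) m) →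
             (∀ r → f (lookup xs r) ≡ f (lookup ys r)) → (f power m) xs ≡ (f power m) ys
power-cong f xs ys eq = cong mean (Vec-ext {xs = Vec.map f xs} {Vec.map f ys} λ r → trans (lookup-map r f xs) (trans (eq r) (sym (lookup-map r f ys))))

module _ {Γ : Language d ℓ} where

  -- Component `r` of the image costs in the mean at most the average over the rows other than `r`,
  -- and by `sum-average-punchIn` these bounds add up to the sum of all costs.
  leaveOneOut-generalized : ∀ (ν : Distribution (Points d (suc k)) (Fin d)) → IsFractionalPolymorphism Γ ν →
                            IsGeneralized Γ (pushforward leaveOneOut ν)
  leaveOneOut-generalized {k = k} ν ν-poly {n} f f∈Γ xs xs∈dom =
    subst (λ u → expectation ρ F ≤ℝ∞ Maybe.map fromℚ u) (sym (power-finite f xs v f≡v))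
      (MeanAtMost⇒expectation ρ F
        (MeanAtMost-pushforward leaveOneOut ν F (MeanAtMost-mono ν
          (λ g → ≤∞-reflexive (power-tabulate f (coordinatewise (leaveOneOut g) xs) (λ r → f (omitting r g))
                   (λ r → cong f (row-leaveOneOut g xs r))))
          (MeanAtMost-weaken ν (≤-reflexive (cong (+ 1 / suc (suc k) *_) (sum-average-punchIn v)))
            (MeanAtMost-mean ν (λ r g → f (omitting r g)) (λ r → average (v ∘ punchIn r))
              (λ r → member-improves {Γ = Γ} ν ν-poly f f∈Γ (λ s → lookup xs (punchIn r s)) (v ∘ punchIn r)
                (λ s → ≤∞-reflexive (f≡v (punchIn r s)))))))))
    where
    ρ = pushforward leaveOneOut ν
    omitting : Fin (suc (suc k)) → (Points d (suc k) → Fin d) → Points d n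
    omitting r g = applyRows g (λ s → lookup xs (punchIn r s))
    F : Map d (suc (suc k)) → ℚ ⁺
    F h = (f power suc (suc k)) (coordinatewise h xs)
    v : Fin (suc (suc k)) → ℚ
    v r = proj₁ (dom⇒finite (xs∈dom r))
    f≡v : ∀ r → f (lookup xs r) ≡ [ v r ]
    f≡v r = proj₂ (dom⇒finite (xs∈dom r))

  leaveOneOut-supp : ∀ {ω : Distribution (Points d (suc (suc k))) (Points d (suc (suc k)))} → IsMaximal Γ ω →
                     ∀ (ν : Distribution (Points d (suc k)) (Fin d)) → IsFractionalPolymorphism Γ ν → IsSymmetric ν →
                     All (λ (_ , g) → leaveOneOut g ∈ supp ω) (atoms ν)
  leaveOneOut-supp {k = k} {ω} ω-max ν ν-poly ν-sym =
    All.map⁻ (All-atoms⇒supp ρ (λ h h∈ρ → IsMaximal.maximal ω-max ρ (leaveOneOut-generalized ν ν-poly) ρ⊆Ω h∈ρ))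
    where
    ρ = pushforward leaveOneOut ν
    ρ⊆Ω : supp ρ ⊆ Ω
    ρ⊆Ω h∈ρ =
      let (g-sym , h≗g) = All.lookupAny (All-atoms⇒supp ν ν-sym) (Any.map⁻ h∈ρ)
      in Ω-resp-≗ h≗g (leaveOneOut-Ω g-sym)

  dirac : (A → B) → Distribution A B
  dirac h .atoms            = (fromℚ 1ℚ , h) ∷ []
  dirac h .weights-positive = (1ℚ , positive⁻¹ 1ℚ , 0 , λ _ _ → ≤-refl) ∷ []
  dirac h .weights-total    =
    (λ ε 0<ε → 0 , λ _ _ → subst (_≤ℚ 1ℚ + ε) (sym (+-identityʳ 1ℚ)) (1≤1+ε ε 0<ε)) ,
    (λ ε 0<ε → 0 , λ _ _ → subst (λ z → 1ℚ ≤ℚ z + ε) (sym (+-identityʳ 1ℚ)) (1≤1+ε ε 0<ε))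
    where
    1≤1+ε : ∀ ε → 0ℚ < ε → 1ℚ ≤ℚ 1ℚ + ε
    1≤1+ε ε 0<ε = subst (_≤ℚ 1ℚ + ε) (+-identityʳ 1ℚ) (+-monoʳ-≤ 1ℚ (<⇒≤ 0<ε))

  -- The point mass at `h` is a generalized fractional polymorphism with support in `Ω`, so
  -- maximality applies to it.
  deterministic-supp : ∀ {ω : Distribution (Points d (suc m)) (Points d (suc m))} → IsMaximal Γ ω → ∀ h → Ω h →
                       (∀ {n} (f : CostFunction d n) → Member Γ f → ∀ xs → (∀ r → lookup xs r ∈ dom f) →
                        (f power suc m) (coordinatewise h xs) ≡ (f power suc m) xs) →
                       h ∈ supp ω
  deterministic-supp {m = m} ω-max h h∈Ω preserves =
    IsMaximal.maximal ω-max (dirac h)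
      (λ f f∈Γ xs xs∈dom →
        let eq = power-finite f xs _ (λ r → proj₂ (dom⇒finite (xs∈dom r)))
            c = average (λ r → proj₁ (dom⇒finite (xs∈dom r)))
        in subst (λ u → expectation (dirac h) (λ h → (f power suc m) (coordinatewise h xs)) ≤ℝ∞ Maybe.map fromℚ u) (sym eq)
             (MeanAtMost⇒expectation (dirac h) (λ h → (f power suc m) (coordinatewise h xs))
               (mean-at-most (λ _ → c) (≤∞-reflexive (trans (preserves f f∈Γ xs xs∈dom) eq) ∷ []) (weighted-const (dirac h) c))))
      (λ { (here g≗h) → Ω-resp-≗ g≗h h∈Ω })
      (here (λ _ → refl))

-- Members of supp ω

orbit-refl : ∀ (ω : Distribution (Points d m) (Points d m)) x → x ∈ 𝔾-orbit ω x
orbit-refl ω x = id , ([] , [] , λ _ → refl) , refl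

orbit-closed : ∀ (ω : Distribution (Points d m) (Points d m)) {x̂ x h} → h ∈ supp ω →
               x ∈ 𝔾-orbit ω x̂ → h x ∈ 𝔾-orbit ω x̂
orbit-closed ω {h = h} h∈ω (g , (hs , hs∈ω , g≗hs) , x≡gx̂) =
  h ∘ g , (h ∷ hs , h∈ω ∷ hs∈ω , λ y → cong h (g≗hs y)) , cong h x≡gx̂

module _ {b : ℕ} (block : Fin d → Fin b) where

  SameBlock : Points d m → Set
  SameBlock x = ∀ r s → block (lookup x r) ≡ block (lookup x s)

  sameBlock? : (x : Points d m) → Dec (SameBlock x)
  sameBlock? x = Fin.all? λ r → Fin.all? λ s → block (lookup x r) Fin.≟ block (lookup x s)

  collapse : Fin d → Map d m
  collapse e x with sameBlock? x
  ... | yes _ = x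
  ... | no  _ = Vec.replicate _ e

  collapse-same : ∀ e {x : Points d m} → SameBlock x → collapse e x ≡ x
  collapse-same e {x} same with sameBlock? x
  ... | yes _    = refl
  ... | no  ¬same = ⊥-elim (¬same same)

  collapse-different : ∀ e {x : Points d m} → ¬ SameBlock x → collapse e x ≡ Vec.replicate _ e
  collapse-different e {x} ¬same with sameBlock? x
  ... | yes same = ⊥-elim (¬same same)
  ... | no  _    = refl

  -- Lying in one block is invariant under permutations, and constant tuples are fixed by them. In
  -- the second branch the inverse of `π` carries a common block back to `x`.
  collapse-Ω : ∀ e → Ω (collapse {m} e)
  collapse-Ω {m = m} e π x with sameBlock? x
  ... | yes same = sym (collapse-same e λ r s →
    subst₂ (λ p q → block p ≡ block q) (sym (lookup-permute π x r)) (sym (lookup-permute π x s))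
      (same (π ⟨$⟩ʳ r) (π ⟨$⟩ʳ s)))
  ... | no ¬same = trans
    (Vec-ext λ r → trans (lookup-permute π (Vec.replicate m e) r)
      (trans (lookup-replicate (π ⟨$⟩ʳ r) e) (sym (lookup-replicate r e))))
    (sym (collapse-different e λ same → ¬same λ r s →
      subst₂ (λ p q → block p ≡ block q) (unpermute r) (unpermute s) (same (π ⟨$⟩ˡ r) (π ⟨$⟩ˡ s))))
    where
    unpermute : ∀ r → lookup (permute π x) (π ⟨$⟩ˡ r) ≡ lookup x r
    unpermute r = trans (lookup-permute π x (π ⟨$⟩ˡ r)) (cong (lookup x) (inverseʳ π))

equality-diagonal : ∀ (x : Points d 2) → lookup x zero ≡ lookup x (suc zero) → equality x ≡ [ 0ℚ ]
equality-diagonal (a ∷ b ∷ []) a≡b with a Fin.≟ b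
... | yes _   = refl
... | no  a≢b = ⊥-elim (a≢b a≡b)

equality-finite : ∀ (x : Points d 2) {v} → equality x ≡ [ v ] → lookup x zero ≡ lookup x (suc zero)
equality-finite (a ∷ b ∷ []) eq with a Fin.≟ b
... | yes a≡b = a≡b
equality-finite (a ∷ b ∷ []) () | no _

-- Finiteness of the domain decides this. The decision is wanted because `dom-in-block` speaks only
-- of functions other than equality.
isEquality? : ∀ (f : CostFunction d n) → Dec (IsEquality f)
isEquality? {n = 0} f = no λ ()
isEquality? {n = 1} f = no λ ()
isEquality? {n = 2} f =
  map′ (λ { eq (a ∷ b ∷ []) → eq a b }) (λ eq a b → eq (a ∷ b ∷ []))
    (Fin.all? λ a → Fin.all? λ b → Maybe.≡-dec _≟_ (f (a ∷ b ∷ [])) (equality (a ∷ b ∷ [])))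
isEquality? {n = suc (suc (suc n))} f = no λ ()

-- Every row of the domain has two equal entries, so the two columns coincide and so do their images
-- under `h`.
coordinatewise-equality : ∀ (h : Map d m) {n} (f : CostFunction d n) → IsEquality f → ∀ xs → (∀ r → lookup xs r ∈ dom f) →
                          ∀ r → f (lookup (coordinatewise h xs) r) ≡ f (lookup xs r)
coordinatewise-equality h {0} f () xs xs∈dom r
coordinatewise-equality h {1} f () xs xs∈dom r
coordinatewise-equality h {suc (suc (suc n))} f () xs xs∈dom r
coordinatewise-equality {d = d} h {2} f f≗equality xs xs∈dom r =
  trans (trans (f≗equality y) (equality-diagonal y y₀≡y₁))
        (sym (trans (f≗equality (lookup xs r)) (equality-diagonal (lookup xs r) (diagonal r))))
  where
  y : Points d 2
  y = lookup (coordinatewise h xs) r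
  diagonal : ∀ r → lookup (lookup xs r) zero ≡ lookup (lookup xs r) (suc zero)
  diagonal r = equality-finite (lookup xs r) (trans (sym (f≗equality (lookup xs r))) (proj₂ (dom⇒finite (xs∈dom r))))
  coordinate : ∀ j → lookup y j ≡ lookup (h (column (lookup xs) j)) r
  coordinate j = trans (cong (λ x → lookup x j) (row-coordinatewise h xs r))
                       (lookup-applyRows (λ x → lookup (h x) r) (lookup xs) j)
  y₀≡y₁ : lookup y zero ≡ lookup y (suc zero)
  y₀≡y₁ = trans (coordinate zero) (trans (cong (λ x → lookup (h x) r) (tabulate-cong diagonal)) (sym (coordinate (suc zero))))

module _ {Γ : Language d ℓ} (Γ-block : BlockFinite Γ) where
  open BlockFinite Γ-block

  collapse-supp : ∀ {ω : Distribution (Points d (suc m)) (Points d (suc m))} → IsMaximal Γ ω → ∀ e → collapse block e ∈ supp ω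
  collapse-supp {m = m} ω-max e = deterministic-supp ω-max (collapse block e) (collapse-Ω block e) λ f f∈Γ xs xs∈dom →
    power-cong f (coordinatewise (collapse block e) xs) xs (preserved f f∈Γ xs xs∈dom)
    where
    preserved : ∀ {n} (f : CostFunction d n) → Member Γ f → ∀ xs → (∀ r → lookup xs r ∈ dom f) →
                ∀ (r : Fin (suc m)) → f (lookup (coordinatewise (collapse block e) xs) r) ≡ f (lookup xs r)
    preserved f f∈Γ xs xs∈dom r with isEquality? f
    ... | yes f-eq = coordinatewise-equality (collapse block e) f f-eq xs xs∈dom r
    ... | no f-neq = cong f (trans (row-coordinatewise (collapse block e) xs r) (Vec-ext λ j →
      trans (lookup-applyRows (λ x → lookup (collapse block e x) r) (lookup xs) j)
        (trans (cong (λ x → lookup x r) (collapse-same block e (same j))) (lookup∘tabulate (λ r → lookup (lookup xs r) j) r))))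
      where
      blocks = dom-in-block f f∈Γ f-neq
      in-block : ∀ r j → block (lookup (lookup xs r) j) ≡ lookup (proj₁ blocks) j
      in-block r j = trans (sym (lookup-map j block (lookup xs r))) (cong (λ v → lookup v j) (proj₂ blocks (lookup xs r) (xs∈dom r)))
      same : ∀ j → SameBlock block (column (lookup xs) j)
      same j r s = subst₂ (λ p q → block p ≡ block q)
        (sym (lookup∘tabulate (λ r → lookup (lookup xs r) j) r)) (sym (lookup∘tabulate (λ r → lookup (lookup xs r) j) s))
        (trans (in-block r j) (sym (in-block s j)))

  -- Each constraint keeps a finite cost by `retract-dom`. Nothing relates `v′` to `v`: the
  -- retraction may raise the cost.
  objective-retract : ∀ a (cs : List (Constraint Γ n)) z {v} → objective cs z ≡ [ v ] →
                      ∃[ v′ ] objective cs (Vec.map (retract a) z) ≡ [ v′ ]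
  objective-retract a []       z eq = 0ℚ , refl
  objective-retract a (con ∷ cs) z eq =
    let (u , v , cost≡u , rest≡v) = +∞-finite (cost (Vec.map (lookup z) scope)) (objective cs z) eq
        (u′ , cost≡u′) = dom⇒finite (retract-dom a cost member (Vec.map (lookup z) scope) (finite⇒dom cost≡u))
        (v′ , rest≡v′) = objective-retract a cs z rest≡v
    in u′ + v′ , cong₂ _+∞_ (trans (cong cost map-scope) cost≡u′) rest≡v′
    where
    open Constraint con
    +∞-finite : ∀ s t {w} → s +∞ t ≡ [ w ] → ∃[ u ] ∃[ v ] s ≡ [ u ] × t ≡ [ v ]
    +∞-finite [ u ] [ v ] _ = u , v , refl , refl
    map-scope : Vec.map (lookup (Vec.map (retract a) z)) scope ≡ Vec.map (retract a) (Vec.map (lookup z) scope)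
    map-scope = Vec-ext λ j → begin
      lookup (Vec.map (lookup (Vec.map (retract a) z)) scope) j   ≡⟨ lookup-map j (lookup (Vec.map (retract a) z)) scope ⟩
      lookup (Vec.map (retract a) z) (lookup scope j)             ≡⟨ lookup-map (lookup scope j) (retract a) z ⟩
      retract a (lookup z (lookup scope j))                       ≡⟨ cong (retract a) (lookup-map j (lookup z) scope) ⟨
      retract a (lookup (Vec.map (lookup z) scope) j)             ≡⟨ lookup-map j (retract a) (Vec.map (lookup z) scope) ⟨
      lookup (Vec.map (retract a) (Vec.map (lookup z) scope)) j   ∎
      where open ≡-Reasoning

  ⟨⟩-retract : ∀ a (f : CostFunction d n) → ⟨ Γ ⟩ f → ∀ x {v} → f x ≡ [ v ] → ∃[ v′ ] f (Vec.map (retract a) x) ≡ [ v′ ]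
  ⟨⟩-retract a f (l , cs , minimal) x f≡v =
    let (y , fx≡) = proj₂ (minimal x)
        (v′ , eq) = objective-retract a cs (x Vec.++ y) (trans (sym fx≡) f≡v)
        (v″ , f≡ , _) = finite-below (≤∞-trans (proj₁ (minimal (Vec.map (retract a) x)) (Vec.map (retract a) y))
                          (≤∞-reflexive (trans (cong (objective cs) (sym (map-++ (retract a) x y))) eq)))
    in v″ , f≡

opposite-≢ : ∀ {i j : Fin 2} → i ≢ j → j ≡ opposite i
opposite-≢ {zero}     {zero}     i≢j = ⊥-elim (i≢j refl)
opposite-≢ {zero}     {suc zero} i≢j = refl
opposite-≢ {suc zero} {zero}     i≢j = refl
opposite-≢ {suc zero} {suc zero} i≢j = ⊥-elim (i≢j refl)

i≢opposite : ∀ (i : Fin 2) → i ≢ opposite i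
i≢opposite zero       ()
i≢opposite (suc zero) ()

swap : Map d 2
swap x = tabulate (lookup x ∘ opposite)

lookup-swap : ∀ (x : Points d 2) i → lookup (swap x) i ≡ lookup x (opposite i)
lookup-swap x = lookup∘tabulate (lookup x ∘ opposite)

-- An injective map of `Fin 2` sends the other index to the other image, so every permutation
-- commutes with `opposite`.
swap-Ω : Ω (swap {d})
swap-Ω π x = tabulate-cong λ i → begin
  lookup (swap x) (π ⟨$⟩ʳ i)           ≡⟨ lookup-swap x (π ⟨$⟩ʳ i) ⟩
  lookup x (opposite (π ⟨$⟩ʳ i))       ≡⟨ cong (lookup x) (opposite-≢ λ eq → i≢opposite i (Injection.injective (↔⇒↣ π) eq)) ⟨
  lookup x (π ⟨$⟩ʳ opposite i)         ≡⟨ lookup-permute π x (opposite i) ⟨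
  lookup (permute π x) (opposite i)    ∎
  where open ≡-Reasoning

swap-supp : ∀ {Γ : Language d ℓ} {ω : Distribution (Points d 2) (Points d 2)} → IsMaximal Γ ω → swap ∈ supp ω
swap-supp ω-max = deterministic-supp ω-max swap swap-Ω λ f f∈Γ xs xs∈dom →
  let v = λ r → proj₁ (dom⇒finite (xs∈dom r))
      f≡v = λ r → proj₂ (dom⇒finite (xs∈dom r))
  in trans
    (power-finite f (coordinatewise swap xs) (v ∘ opposite) (λ r → trans (cong f (swapped-row xs r)) (f≡v (opposite r))))
    -- The sum over `Fin 2` unfolds to two terms followed by `0ℚ`; the law exchanges the two.
    (trans (cong (λ z → [ + 1 / 2 * z ]) (x∙yz≈y∙xz (v (suc zero)) (v zero) 0ℚ)) (sym (power-finite f xs v f≡v)))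
  where
  swapped-row : ∀ {n} (xs : Vec (Points _ n) 2) r → lookup (coordinatewise swap xs) r ≡ lookup xs (opposite r)
  swapped-row xs r = trans (row-coordinatewise swap xs r) (Vec-ext λ j →
    trans (lookup-applyRows (λ x → lookup (swap x) r) (lookup xs) j)
      (trans (lookup-swap (column (lookup xs) j) r) (lookup∘tabulate (λ r → lookup (lookup xs r) j) (opposite r))))

-- Descent on finite types

record Finite (A : Set a) : Set a where
  field
    {size}      : ℕ
    code        : A → Fin size
    decode      : Fin size → A
    decode-code : ∀ x → decode (code x) ≡ x

Finite-Fin : Finite (Fin n)
Finite-Fin = record { code = id ; decode = id ; decode-code = λ _ → refl }

Finite-Vec : Finite A → Finite (Vec A n)
Finite-Vec A-finite = record
  { code        = λ xs → Fin.funToFin (code ∘ lookup xs)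
  ; decode      = λ i → tabulate (decode ∘ Fin.finToFun i)
  ; decode-code = λ xs → trans
      (tabulate-cong λ i → trans (cong decode (Fin.finToFun-funToFin (code ∘ lookup xs) i)) (decode-code (lookup xs i)))
      (tabulate∘lookup xs)
  }
  where open Finite A-finite

-- Rationals admit infinite descent, but the order pulled back to the codes is a strict partial
-- order on some `Fin n`, hence well-founded.
Finite-wellFounded : Finite A → (P : A → ℚ) → WellFounded (λ x y → P x < P y)
Finite-wellFounded A-finite P = Subrelation.wellFounded
  (λ {x} {y} → subst₂ (λ x y → P x < P y) (sym (decode-code x)) (sym (decode-code y)))
  (On.wellFounded code (Fin.spo-wellFounded (On.isStrictPartialOrder (P ∘ decode) <-isStrictPartialOrder)))
  where open Finite A-finite

-- Takes the place of choosing an element of `S` with least potential, which would require deciding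
-- `S`.
descent : Finite A → (P : A → ℚ) {S : A → Set ℓ} {G : Set b} →
          (∀ x → S x → G ⊎ ∃[ y ] S y × P y < P x) → ∀ x → S x → G
descent A-finite P {S} {G} step x = go x (Finite-wellFounded A-finite P x)
  where
  go : ∀ x → Acc (λ x y → P x < P y) x → S x → G
  go x (acc rec) Sx with step x Sx
  ... | inj₁ g                = g
  ... | inj₂ (y , Sy , Py<Px) = go y (rec Py<Px) Sy

-- Transpositions and omitted indices.

transpose-matchˡ : ∀ (i j : Fin n) → transpose i j ⟨$⟩ʳ i ≡ j
transpose-matchˡ i j rewrite dec-true (i Fin.≟ i) refl = refl

transpose-other : ∀ {i j r : Fin n} → r ≢ i → r ≢ j → transpose i j ⟨$⟩ʳ r ≡ r
transpose-other {i = i} {j} {r} r≢i r≢j rewrite dec-false (r Fin.≟ i) r≢i | dec-false (r Fin.≟ j) r≢j = refl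

punchIn-cases : ∀ {p} (P : Fin (suc n) → Set p) i → P i → (∀ s → P (punchIn i s)) → ∀ r → P r
punchIn-cases P i Pi Ppunch r with i Fin.≟ r
... | yes refl = Pi
... | no  i≢r  = subst P (Fin.punchIn-punchOut i≢r) (Ppunch (punchOut i≢r))

-- Equal coordinates from a cyclic operation.

rows : A → A → A → Fin (suc (suc k)) → A
rows x y z zero          = x
rows x y z (suc zero)    = y
rows x y z (suc (suc _)) = z

column-rows : ∀ (x y z : Vec A n) i →
              column (rows {k = k} x y z) i ≡ lookup x i ∷ lookup y i ∷ Vec.replicate k (lookup z i)
column-rows x y z i = cong (λ zs → lookup x i ∷ lookup y i ∷ zs)
  (Vec-ext λ r → trans (lookup∘tabulate (λ _ → lookup z i) r) (sym (lookup-replicate r (lookup z i))))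

replicate-∷ʳ : ∀ k (x : A) → Vec.replicate k x Vec.∷ʳ x ≡ x ∷ Vec.replicate k x
replicate-∷ʳ zero    x = refl
replicate-∷ʳ (suc k) x = cong (x ∷_) (replicate-∷ʳ k x)

-- Applying a cyclic operation to the rows x, x′, y, …, y, where (xᵢ, xⱼ) = (a, b),
-- (x′ᵢ, x′ⱼ) = (b, a) and (yᵢ, yⱼ) = (a, a), gives columns i and j that are
-- rotations of each other, and the mean cost of these rows is less than f y
-- unless y is already minimal.
module _ {i j : Fin m} {f : CostFunction d m} {μ : ℚ} (μ-least : ∀ y → [ μ ] ≤∞ f y) where

  -- The entries in columns `i` and `j` are read as an edge: `y` is a loop at a vertex, and `x` and
  -- `x′` are edges of least cost from it to another vertex and back.
  record Loop (y : Points d m) : Set where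
    field
      {x x′}    : Points d m
      {v}       : ℚ
      y-finite  : f y ≡ [ v ]
      x-least   : f x ≡ [ μ ]
      x′-least  : f x′ ≡ [ μ ]
      y-loop    : lookup y j ≡ lookup y i
      x-source  : lookup x i ≡ lookup y i
      x′-target : lookup x′ j ≡ lookup y i
      x-x′      : lookup x j ≡ lookup x′ i

  cyclic-loop : (ν : Distribution (Points d (suc (suc k))) (Fin d)) → Improves ν f → IsCyclic ν →
                ∀ y → Loop y → ∃[ z ] f z ≡ [ μ ] × lookup z i ≡ lookup z j
  cyclic-loop {k = k} ν improves cyclic = descent (Finite-Vec Finite-Fin) (value ∘ f) step
    where
    step : ∀ y → Loop y → (∃[ z ] f z ≡ [ μ ] × lookup z i ≡ lookup z j) ⊎ ∃[ z ] Loop z × value (f z) < value (f y)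
    step y loop with Loop.v loop ≤? μ
    ... | yes v≤μ = inj₁ (y , ≤∞-antisym (≤∞-trans (≤∞-reflexive (Loop.y-finite loop)) (finite≤ v≤μ)) (μ-least y) , sym (Loop.y-loop loop))
    ... | no  v≰μ = improve (MeanAtMost-attained-with ν
                      (All.zip (All-atoms⇒supp ν cyclic , All.zip (stays-least x x′ x-least x′-least , stays-least x′ x x′-least x-least)))
                      (improves (rows x x′ y) (rows μ μ v) λ
                        { zero → ≤∞-reflexive x-least ; (suc zero) → ≤∞-reflexive x′-least ; (suc (suc _)) → ≤∞-reflexive y-finite }))
      where
      open Loop loop
      α = lookup y i
      β = lookup x′ i
      -- With `x` in place of `y` the rows have mean `μ`, so their image stays minimal. This and the
      -- same with `x` and `x′` exchanged give the edges for the new loop: they join `g` of (α, β,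
      -- α, ...), the vertex of that loop, with `g` of (β, α, β, ...).
      stays-least : ∀ x x′ → f x ≡ [ μ ] → f x′ ≡ [ μ ] → All (λ (_ , g) → f (applyRows g (rows {k = k} x x′ x)) ≡ [ μ ]) (atoms ν)
      stays-least x x′ x-least x′-least = MeanAtMost-tight ν
        (MeanAtMost-weaken ν (≤-reflexive (average-const (suc k) μ)) (improves (rows x x′ x) (λ _ → μ) λ
          { zero → ≤∞-reflexive x-least ; (suc zero) → ≤∞-reflexive x′-least ; (suc (suc _)) → ≤∞-reflexive x-least }))
        (All.universal (λ (_ , g) → μ-least (applyRows g (rows x x′ x))) (atoms ν))
      rotation : rotate (α ∷ β ∷ Vec.replicate k α) ≡ β ∷ α ∷ Vec.replicate k α
      rotation = cong (β ∷_) (replicate-∷ʳ k α)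
      coordinate : ∀ (g : Points d (suc (suc k)) → Fin d) x y z l {p q r} → lookup x l ≡ p → lookup y l ≡ q → lookup z l ≡ r →
                   lookup (applyRows g (rows x y z)) l ≡ g (p ∷ q ∷ Vec.replicate k r)
      coordinate g x y z l refl refl refl = trans (lookup-applyRows g (rows x y z) l) (cong g (column-rows x y z l))
      average<v : average (rows {k = k} μ μ v) < v
      average<v = subst (average (rows {k = k} μ μ v) <_) (average-const (suc k) v)
        (average-mono-< {n = suc k} {s = rows {k = k} μ μ v} {t = λ _ → v}
          (λ { zero → <⇒≤ (≰⇒> v≰μ) ; (suc zero) → <⇒≤ (≰⇒> v≰μ) ; (suc (suc _)) → ≤-refl }) zero (≰⇒> v≰μ))
      improve : ∃[ g ] ((∀ x → g (rotate x) ≡ g x) × f (applyRows g (rows x x′ x)) ≡ [ μ ] × f (applyRows g (rows x′ x x′)) ≡ [ μ ])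
                  × f (applyRows g (rows x x′ y)) ≤∞ [ average (rows {k = k} μ μ v) ] →
                (∃[ z ] f z ≡ [ μ ] × lookup z i ≡ lookup z j) ⊎ ∃[ z ] Loop z × value (f z) < value (f y)
      improve (g , (g-cyclic , z-least , z′-least) , fz≤) =
        let (w , fz≡w , w≤) = finite-below fz≤
        in inj₂ (applyRows g (rows x x′ y) ,
             record
               { y-finite  = fz≡w
               ; x-least   = z-least
               ; x′-least  = z′-least
               ; y-loop    = trans (coordinate g x x′ y j x-x′ x′-target y-loop)
                               (trans (cong g (sym rotation)) (trans (g-cyclic (α ∷ β ∷ Vec.replicate k α)) (sym (coordinate g x x′ y i x-source refl refl))))
               ; x-source  = trans (coordinate g x x′ x i x-source refl x-source) (sym (coordinate g x x′ y i x-source refl refl))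
               ; x′-target = trans (coordinate g x′ x x′ j x′-target x-x′ x′-target) (sym (coordinate g x x′ y i x-source refl refl))
               ; x-x′      = trans (coordinate g x x′ x j x-x′ x′-target x-x′) (sym (coordinate g x′ x x′ i refl x-source refl))
               } ,
             subst₂ (λ s t → value s < value t) (sym fz≡w) (sym y-finite) (≤-<-trans w≤ average<v))

-- Equal coordinates from a symmetric operation.

module _ {i j : Fin (suc (suc (suc k)))} (i≢j : i ≢ j) {f : CostFunction d (suc (suc (suc k)))} {μ : ℚ}
         (μ-least : ∀ y → [ μ ] ≤∞ f y) {R : Points d (suc (suc (suc k))) → Set} (R-least : ∀ {x} → R x → f x ≡ [ μ ])
         (ν : Distribution (Points d (suc (suc k))) (Fin d)) (improves : Improves ν f)
         (R-closed : All (λ (_ , g) → SymmetricOp g × (∀ x → R x → R (leaveOneOut g x))) (atoms ν)) where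

  private
    M : ℕ
    M = suc (suc (suc k))
    τ : Fin M → Fin M
    τ = transpose i j ⟨$⟩ʳ_
    Goal = ∃[ z ] f z ≡ [ μ ] × lookup z i ≡ lookup z j

  -- Column `j` lists `x` permuted by `τ` with index `r` omitted, which is `symmetric-omit` for a
  -- transposition. The hypotheses concern the kept rows alone, so that `initial-Rows` can use this
  -- before a suitable row `j` exists.
  transposed-columns : ∀ {g} → SymmetricOp g → ∀ (x : Points d M) (Y : Fin M → Points d M) r →
    (∀ s → lookup (Y (punchIn r s)) i ≡ lookup x (punchIn r s)) →
    (∀ s → lookup (Y (punchIn r s)) j ≡ lookup x (τ (punchIn r s))) →
    lookup (applyRows g (Y ∘ punchIn r)) i ≡ lookup (leaveOneOut g x) r ×
    lookup (applyRows g (Y ∘ punchIn r)) j ≡ lookup (leaveOneOut g x) (τ r)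
  transposed-columns {g} g-sym x Y r Yᵢ Yⱼ =
    trans (lookup-applyRows g (Y ∘ punchIn r) i) (trans (cong g (tabulate-cong Yᵢ)) (sym (lookup-leaveOneOut g x r))) ,
    trans (lookup-applyRows g (Y ∘ punchIn r) j) (trans (cong g (tabulate-cong Yⱼ))
      (trans (symmetric-omit g-sym (transpose i j) (lookup x) r) (sym (lookup-leaveOneOut g x (τ r)))))

  -- For `r` other than `i` and `j` the transposition fixes `r`, so row `r` has equal entries in
  -- columns `i` and `j`; once such a row costs `μ`, the goal is reached.
  record Rows (Y : Fin M → Points d M) : Set where
    field
      {x}      : Points d M
      {v}      : Fin M → ℚ
      x∈R      : R x
      columnᵢ  : ∀ r → lookup (Y r) i ≡ lookup x r
      columnⱼ  : ∀ r → lookup (Y r) j ≡ lookup x (τ r)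
      finite   : ∀ r → f (Y r) ≡ [ v r ]
      vᵢ-least : v i ≡ μ

  -- The total excess up to a constant. Its argument is a vector and not a function, because
  -- `decode-code` asks for propositional equality.
  cost : Vec (Points d M) M → ℚ
  cost Y = sum (λ r → value (f (lookup Y (punchIn i r))))

  cost-tabulate : ∀ Y v → (∀ r → f (Y (punchIn i r)) ≡ [ v r ]) → cost (tabulate Y) ≡ sum v
  cost-tabulate Y v f≡v = sum-cong-≗ λ r → cong value (trans (cong f (lookup∘tabulate Y (punchIn i r))) (f≡v r))

  -- Here at least three coordinates are used: `punchIn i` takes different values at 0 and 1, and at
  -- most one of them is `j`.
  third : ∃[ r ] punchIn i r ≢ j
  third with punchIn i zero Fin.≟ j
  ... | no  ≢j = zero , ≢j
  ... | yes ≡j = suc zero , λ ≡j′ → Fin.0≢1+n (Fin.punchIn-injective i zero (suc zero) (trans ≡j (sym ≡j′)))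

  -- The test concerns a row fixed by `τ`. If its cost exceeds `μ`, then some entry of `v` exceeds
  -- the least one, `v i`, and `sum-average-punchIn-<` is strict.
  Rows-step : ∀ Y → Rows Y → Goal ⊎ ∃[ Z ] Rows Z × cost (tabulate Z) < cost (tabulate Y)
  Rows-step Y Y-rows = step (Rows.v Y-rows (punchIn i r₀) ≤? μ)
    where
    open Rows Y-rows
    r₀ = proj₁ third
    τr₀≡r₀ : τ (punchIn i r₀) ≡ punchIn i r₀
    τr₀≡r₀ = transpose-other (Fin.punchInᵢ≢i i r₀) (proj₂ third)
    μ≤v : ∀ r → v i ≤ℚ v r
    μ≤v r = ≤-trans (≤-reflexive vᵢ-least) (NonStrict.[≤]-injective _≤ℚ_ (≤∞-trans (μ-least (Y r)) (≤∞-reflexive (finite r))))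
    c : Fin (suc (suc k)) → ℚ
    c r = average (λ s → v (punchIn (punchIn i r) s))
    U : (Points d (suc (suc k)) → Fin d) → Fin (suc (suc k)) → Points d M
    U g r = applyRows g (Y ∘ punchIn (punchIn i r))
    -- The rows are bounded jointly, since one operation has to decrease their total; separate
    -- bounds could be attained by different operations.
    total-cost : MeanAtMost ν (λ g → sum∞ (tabulate (λ r → f (U g r)))) (sum c)
    total-cost = MeanAtMost-sum ν (λ r g → f (U g r)) c λ r →
      improves (Y ∘ punchIn (punchIn i r)) (λ s → v (punchIn (punchIn i r) s)) (λ s → ≤∞-reflexive (finite (punchIn (punchIn i r) s)))
    step : Dec (v (punchIn i r₀) ≤ℚ μ) → Goal ⊎ ∃[ Z ] Rows Z × cost (tabulate Z) < cost (tabulate Y)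
    step (yes v≤μ) = inj₁ (Y (punchIn i r₀) ,
      ≤∞-antisym (≤∞-trans (≤∞-reflexive (finite (punchIn i r₀))) (finite≤ v≤μ)) (μ-least (Y (punchIn i r₀))) ,
      trans (columnᵢ (punchIn i r₀)) (trans (cong (lookup x) (sym τr₀≡r₀)) (sym (columnⱼ (punchIn i r₀)))))
    step (no v≰μ) = improve (MeanAtMost-attained-with ν R-closed total-cost)
      where
      sum-c< : sum c < sum (v ∘ punchIn i)
      sum-c< = sum-average-punchIn-< v i μ≤v r₀ (≤-<-trans (≤-reflexive vᵢ-least) (≰⇒> v≰μ))
      improve : ∃[ g ] (SymmetricOp g × (∀ x → R x → R (leaveOneOut g x))) × sum∞ (tabulate (λ r → f (U g r))) ≤∞ [ sum c ] →
                Goal ⊎ ∃[ Z ] Rows Z × cost (tabulate Z) < cost (tabulate Y)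
      improve (g , (g-sym , g-closed) , cost≤) =
        let (w , f≡w , Σw≤) = sum∞-split (λ r → f (U g r)) cost≤
            x′ = leaveOneOut g x
            x′∈R = g-closed x x∈R
            -- Row `i` is the new tuple itself, of cost `μ` because `R` is closed, and not the image
            -- of the rows other than `i`.
            Z = insertAt (U g) i x′
            Zᵢ = insertAt-lookup (U g) i x′
            Zᵣ = insertAt-punchIn (U g) i x′
            columns = λ r → transposed-columns g-sym x Y r (λ s → columnᵢ (punchIn r s)) (λ s → columnⱼ (punchIn r s))
        in inj₂ (Z ,
             record
               { x∈R      = x′∈R
               ; columnᵢ  = punchIn-cases (λ r → lookup (Z r) i ≡ lookup x′ r) i
                              (cong (λ z → lookup z i) Zᵢ)
                              (λ r → trans (cong (λ z → lookup z i) (Zᵣ r)) (proj₁ (columns (punchIn i r))))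
               ; columnⱼ  = punchIn-cases (λ r → lookup (Z r) j ≡ lookup x′ (τ r)) i
                              (trans (cong (λ z → lookup z j) Zᵢ) (cong (lookup x′) (sym (transpose-matchˡ i j))))
                              (λ r → trans (cong (λ z → lookup z j) (Zᵣ r)) (proj₂ (columns (punchIn i r))))
               ; finite   = punchIn-cases (λ r → f (Z r) ≡ [ insertAt w i μ r ]) i
                              (trans (cong f Zᵢ) (trans (R-least x′∈R) (cong [_] (sym (insertAt-lookup w i μ)))))
                              (λ r → trans (cong f (Zᵣ r)) (trans (f≡w r) (cong [_] (sym (insertAt-punchIn w i μ r)))))
               ; vᵢ-least = insertAt-lookup w i μ
               } ,
             subst₂ _<_
               (sym (cost-tabulate Z w (λ r → trans (cong f (Zᵣ r)) (f≡w r))))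
               (sym (cost-tabulate Y (v ∘ punchIn i) (λ r → finite (punchIn i r))))
               (≤-<-trans Σw≤ sum-c<))

  symmetric-loop : ∀ Y → Rows Y → Goal
  symmetric-loop Y Y-rows =
    descent (Finite-Vec (Finite-Vec Finite-Fin)) cost {S = λ W → ∃[ Y ] W ≡ tabulate Y × Rows Y}
      (λ { _ (Y , refl , Y-rows) → Sum.map₂ (λ (Z , Z-rows , lt) → tabulate Z , (Z , refl , Z-rows) , lt) (Rows-step Y Y-rows) })
      (tabulate Y) (Y , refl , Y-rows)

  Constants : Points d M → Set
  Constants x = ∀ r → ∃[ v ] f (Vec.replicate M (lookup x r)) ≡ [ v ]

  -- The row (xⱼ, xᵢ) of finite cost is obtained from the rows (xᵢ, xⱼ) and
  -- (xᵣ, xᵣ) of the tuple that x is the image of.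
  initial-Rows : ∀ x → R x → Constants x → (∀ x → R x → Goal ⊎ Constants x) → Goal ⊎ ∃[ Y ] Rows Y
  initial-Rows x⁰ x⁰∈R constants⁰ constants =
    -- Row `j` of `Z` is a constant tuple and not the desired (xⱼ, xᵢ), so it is the one left out.
    -- The image of the others becomes row `j` for the new tuple.
    start (MeanAtMost-attained-with ν R-closed (improves (Z ∘ punchIn j) (u ∘ punchIn j) (λ s → ≤∞-reflexive (Z-finite (punchIn j s)))))
    where
    diagonals : Fin (suc (suc k)) → Points d M
    diagonals s = Vec.replicate M (lookup x⁰ (punchIn i s))
    Z : Fin M → Points d M
    Z = insertAt diagonals i x⁰
    Zᵢ = insertAt-lookup diagonals i x⁰
    Zᵣ = insertAt-punchIn diagonals i x⁰
    Z-columnᵢ : ∀ r → lookup (Z r) i ≡ lookup x⁰ r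
    Z-columnᵢ = punchIn-cases (λ r → lookup (Z r) i ≡ lookup x⁰ r) i
      (cong (λ z → lookup z i) Zᵢ)
      (λ s → trans (cong (λ z → lookup z i) (Zᵣ s)) (lookup-replicate i (lookup x⁰ (punchIn i s))))
    Z-columnⱼ : ∀ r → r ≢ j → lookup (Z r) j ≡ lookup x⁰ (τ r)
    Z-columnⱼ = punchIn-cases (λ r → r ≢ j → lookup (Z r) j ≡ lookup x⁰ (τ r)) i
      (λ _ → trans (cong (λ z → lookup z j) Zᵢ) (cong (lookup x⁰) (sym (transpose-matchˡ i j))))
      (λ s s≢j → trans (cong (λ z → lookup z j) (Zᵣ s)) (trans (lookup-replicate j (lookup x⁰ (punchIn i s)))
        (cong (lookup x⁰) (sym (transpose-other (Fin.punchInᵢ≢i i s) s≢j)))))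
    u : Fin M → ℚ
    u = insertAt (λ s → proj₁ (constants⁰ (punchIn i s))) i μ
    Z-finite : ∀ r → f (Z r) ≡ [ u r ]
    Z-finite = punchIn-cases (λ r → f (Z r) ≡ [ u r ]) i
      (trans (cong f Zᵢ) (trans (R-least x⁰∈R) (cong [_] (sym (insertAt-lookup (λ s → proj₁ (constants⁰ (punchIn i s))) i μ)))))
      (λ s → trans (cong f (Zᵣ s)) (trans (proj₂ (constants⁰ (punchIn i s)))
        (cong [_] (sym (insertAt-punchIn (λ s → proj₁ (constants⁰ (punchIn i s))) i μ s)))))
    start : ∃[ g ] (SymmetricOp g × (∀ x → R x → R (leaveOneOut g x))) × f (applyRows g (Z ∘ punchIn j)) ≤∞ [ average (u ∘ punchIn j) ] →
            Goal ⊎ ∃[ Y ] Rows Y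
    -- The rows fixed by `τ` are constant tuples of the new `x`, whose finite cost calls for the
    -- dichotomy a second time.
    start (g , (g-sym , g-closed) , fU≤) = Sum.map₂ build (constants x x∈R)
      where
      x = leaveOneOut g x⁰
      x∈R = g-closed x⁰ x⁰∈R
      U = applyRows g (Z ∘ punchIn j)
      U-columns = transposed-columns g-sym x⁰ Z j (λ s → Z-columnᵢ (punchIn j s)) (λ s → Z-columnⱼ (punchIn j s) (Fin.punchInᵢ≢i j s))
      U-finite = finite-below fU≤
      Row : Fin M → Set
      Row r = ∃[ y ] ∃[ v ] lookup y i ≡ lookup x r × lookup y j ≡ lookup x (τ r) × f y ≡ [ v ] × (r ≡ i → v ≡ μ)
      row : Constants x → ∀ r → Dec (r ≡ i) → Dec (r ≡ j) → Row r
      row constants r (yes refl) _          = x , μ , refl , cong (lookup x) (sym (transpose-matchˡ i j)) , R-least x∈R , λ _ → refl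
      row constants r (no r≢i)   (yes refl) = U , proj₁ U-finite , proj₁ U-columns , proj₂ U-columns , proj₁ (proj₂ U-finite) , λ r≡i → ⊥-elim (r≢i r≡i)
      row constants r (no r≢i)   (no r≢j)   = Vec.replicate M (lookup x r) , proj₁ (constants r) , lookup-replicate i (lookup x r) ,
        trans (lookup-replicate j (lookup x r)) (cong (lookup x) (sym (transpose-other r≢i r≢j))) , proj₂ (constants r) , λ r≡i → ⊥-elim (r≢i r≡i)
      build : Constants x → ∃[ Y ] Rows Y
      build constants = proj₁ ∘ rs , record
        { x∈R      = x∈R
        ; columnᵢ  = λ r → proj₁ (proj₂ (proj₂ (rs r)))
        ; columnⱼ  = λ r → proj₁ (proj₂ (proj₂ (proj₂ (rs r))))
        ; finite   = λ r → proj₁ (proj₂ (proj₂ (proj₂ (proj₂ (rs r)))))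
        ; vᵢ-least = proj₂ (proj₂ (proj₂ (proj₂ (proj₂ (rs i))))) refl
        }
        where
        rs : ∀ r → Row r
        rs r = row constants r (r Fin.≟ i) (r Fin.≟ j)

-- The two cases combined.

least-loop : ∀ (Γ : Language d ℓ) → BlockFinite Γ →
  (ω : Distribution (Points d m) (Points d m)) → IsMaximal Γ ω →
  ((m ≡ 2 × (Σ[ k ∈ ℕ ] 2 ≤ k × (Σ[ ν ∈ Distribution (Points d k) (Fin d) ] IsFractionalPolymorphism Γ ν × IsCyclic ν)))
   ⊎ (3 ≤ m × (Σ[ ν ∈ Distribution (Points d (m ∸ 1)) (Fin d) ] IsFractionalPolymorphism Γ ν × IsSymmetric ν))) →
  ∀ x̂ (f : CostFunction d m) → f ∈ ⟨ Γ ⟩ → ∀ {μ} → (∀ y → [ μ ] ≤∞ f y) → (∀ {x} → x ∈ 𝔾-orbit ω x̂ → f x ≡ [ μ ]) →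
  ∀ (i j : Fin m) → i ≢ j → ∃[ z ] f z ≡ [ μ ] × lookup z i ≡ lookup z j
least-loop {d = d} {m = suc m} Γ Γ-block ω ω-max polymorphism x̂ f f∈Γ {μ} μ-least orbit-least i j i≢j =
  Sum.[ id , cases polymorphism ]′ (constants x̂ (orbit-refl ω x̂))
  where
  open BlockFinite Γ-block
  Goal = ∃[ z ] f z ≡ [ μ ] × lookup z i ≡ lookup z j
  constants : ∀ x → x ∈ 𝔾-orbit ω x̂ → Goal ⊎ (∀ r → ∃[ v ] f (Vec.replicate (suc m) (lookup x r)) ≡ [ v ])
  constants x x∈R with sameBlock? block x
  -- The retraction belonging to `lookup x r` sends every entry of its block to `lookup x r`, so it
  -- makes `x` constant.
  ... | yes same = inj₂ λ r →
    let (v , eq) = ⟨⟩-retract Γ-block (lookup x r) f f∈Γ x (orbit-least x∈R)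
    in v , trans (cong f (Vec-ext λ s → trans (lookup-replicate s (lookup x r))
         (sym (trans (lookup-map s (retract (lookup x r)) x) (retract-block (lookup x r) (lookup x s) (same s r)))))) eq
  ... | no ¬same = inj₁ (Vec.replicate (suc m) e ,
    orbit-least (subst (_∈ 𝔾-orbit ω x̂) (collapse-different block e ¬same) (orbit-closed ω (collapse-supp Γ-block ω-max e) x∈R)) ,
    trans (lookup-replicate i e) (sym (lookup-replicate j e)))
    where e = lookup x i
  cases : ((suc m ≡ 2 × (Σ[ k ∈ ℕ ] 2 ≤ k × (Σ[ ν ∈ Distribution (Points d k) (Fin d) ] IsFractionalPolymorphism Γ ν × IsCyclic ν)))
           ⊎ (3 ≤ suc m × (Σ[ ν ∈ Distribution (Points d m) (Fin d) ] IsFractionalPolymorphism Γ ν × IsSymmetric ν))) →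
          (∀ r → ∃[ v ] f (Vec.replicate (suc m) (lookup x̂ r)) ≡ [ v ]) → Goal
  cases (inj₁ (refl , suc (suc k) , s≤s (s≤s _) , ν , ν-poly , ν-cyclic)) finite =
    cyclic-loop μ-least ν (⟨⟩-improves {Γ = Γ} ν ν-poly f f∈Γ) ν-cyclic (Vec.replicate 2 a₀) record
      { x         = x̂
      ; x′        = swap x̂
      ; y-finite  = proj₂ (finite i)
      ; x-least   = orbit-least (orbit-refl ω x̂)
      ; x′-least  = orbit-least (orbit-closed ω (swap-supp ω-max) (orbit-refl ω x̂))
      ; y-loop    = trans (lookup-replicate j a₀) (sym (lookup-replicate i a₀))
      ; x-source  = sym (lookup-replicate i a₀)
      ; x′-target = trans (lookup-swap x̂ j) (trans (cong (lookup x̂) (sym (opposite-≢ (i≢j ∘ sym)))) (sym (lookup-replicate i a₀)))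
      ; x-x′      = trans (cong (lookup x̂) (opposite-≢ i≢j)) (sym (lookup-swap x̂ i))
      }
    where a₀ = lookup x̂ i
  cases (inj₂ (s≤s (s≤s (s≤s {n = k} _)) , ν , ν-poly , ν-sym)) finite =
    Sum.[ id , (λ (Y , Y-rows) → symmetric-loop i≢j μ-least orbit-least ν improves R-closed Y Y-rows) ]′
      (initial-Rows i≢j μ-least orbit-least ν improves R-closed x̂ (orbit-refl ω x̂) finite constants)
    where
    improves = ⟨⟩-improves {Γ = Γ} ν ν-poly f f∈Γ
    R-closed : All (λ (_ , g) → SymmetricOp g × (∀ x → x ∈ 𝔾-orbit ω x̂ → leaveOneOut g x ∈ 𝔾-orbit ω x̂)) (atoms ν)
    R-closed = All.zip (All-atoms⇒supp ν ν-sym , All.map (λ g∈ω _ → orbit-closed ω g∈ω) (leaveOneOut-supp {Γ = Γ} ω-max ν ν-poly ν-sym))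

theorem7p1 : ∀ {ℓ : Level} {d m : ℕ} (Γ : Language d ℓ) → BlockFinite Γ →
    (ω : Distribution (Points d m) (Points d m)) → IsMaximal Γ ω →
    ((m ≡ 2 × (Σ[ k ∈ ℕ ] 2 ≤ k × (Σ[ ν ∈ Distribution (Points d k) (Fin d) ]
    IsFractionalPolymorphism Γ ν × IsCyclic ν)))
    ⊎ (3 ≤ m × (Σ[ ν ∈ Distribution (Points d (m ∸ 1)) (Fin d) ]
    IsFractionalPolymorphism Γ ν × IsSymmetric ν))) →
    (x̂ : Points d m) → x̂ ∈ Range₁𝔾* ω →
    (f : CostFunction d m) → f ∈ ⟨ Γ ⟩ →
    argmin f ≐ 𝔾-orbit ω x̂ →
    (i j : Fin m) → i ≢ j →
    ∃[ x ] x ∈ argmin f × lookup x i ≡ lookup x j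
theorem7p1 {d = d} {m} Γ Γ-block ω ω-max polymorphism x̂ _ f f∈Γ (_ , orbit⊆argmin) i j i≢j = case (f x̂) refl
  where
  x̂-least : ∀ y → f x̂ ≤∞ f y
  x̂-least = orbit⊆argmin (orbit-refl ω x̂)
  case : ∀ u → f x̂ ≡ u → ∃[ x ] x ∈ argmin f × lookup x i ≡ lookup x j
  -- If the minimum is ∞, every tuple is a minimizer, in particular a constant one.
  case ⊤⁺ fx̂≡∞ = Vec.replicate m e ,
    (λ y → ≤∞-trans (f (Vec.replicate m e) ≤⊤⁺) (subst (_≤∞ f y) fx̂≡∞ (x̂-least y))) ,
    trans (lookup-replicate i e) (sym (lookup-replicate j e))
    where e = lookup x̂ i
  case [ μ ] fx̂≡μ =
    let μ-least = λ y → subst (_≤∞ f y) fx̂≡μ (x̂-least y)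
        (z , fz≡μ , zᵢ≡zⱼ) = least-loop Γ Γ-block ω ω-max polymorphism x̂ f f∈Γ μ-least
          (λ {x} x∈R → ≤∞-antisym (subst (f x ≤∞_) fx̂≡μ (orbit⊆argmin x∈R x̂)) (μ-least x)) i j i≢j
    in z , (λ y → subst (_≤∞ f y) (sym fz≡μ) (μ-least y)) , zᵢ≡zⱼ
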